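{- Let $m$ be a good product of $r$ primes. For every symmetric Boolean function $f$ on $n$ inputs and every depth $d \ge 4$ with $d \equiv 1 \pmod 3$, there exists an $\mathsf{AC}^0[m]$ circuit of depth $d$ and size $\exp(\tilde{O}(n^{3/((r+3)(d-1)-3)}))$ computing $f$.
   Context: A product $m$ of distinct primes $q_1,\ldots,q_r$ is called good if every prime factor of $\phi(m)$ (Euler's totient) divides $m$; e.g. the product of the first $r$ primes is good. A Boolean function is symmetric if its value depends only on the number of ones in the input. An $\mathsf{AC}^0[m]$ circuit is a circuit with unbounded fan-in AND, OR, NOT and $\text{MOD}_m$ gates, where a $\text{MOD}_m$ gate outputs $1$ iff the sum of its inputs (counted with wire multiplicity) is divisible by $m$. Size is the number of gates. $\tilde{O}(\cdot)$ hides polylogarithmic factors in $n$; constants may depend on $m$ and $d$, with $n\to\infty$. -}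

module Defs where

open import Data.Nat using (ℕ; zero; suc; _+_; _*_; _^_; _≤_; _<_; _∸_; NonZero)
open import Data.Nat.Properties using (_≟_)
open import Data.Nat.Divisibility using (_∣_; _∣?_)
open import Data.Nat.GCD using (gcd)
open import Data.Nat.Primality using (Prime)
open import Data.Nat.Logarithm using (⌊log₂_⌋)
open import Data.Bool using (Bool; true; false; not; _∧_; _∨_; if_then_else_)
open import Data.Fin using (Fin; toℕ)
open import Data.Vec using (Vec; []; _∷_; lookup)
open import Data.List using (List; []; _∷_; length; foldr; map; upTo; filter)
open import Data.Nat.ListAction using (product)
open import Data.List.Relation.Unary.Unique.Propositional using (Unique)
open import Data.List.Relation.Unary.All using (All)
open import Data.Sum using (_⊎_; inj₁; inj₂)
open import Data.Product using (Σ; ∃; ∃-syntax; _×_; _,_)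
open import Relation.Binary.PropositionalEquality using (_≡_)
open import Relation.Nullary.Decidable using (does)

totient : ℕ → ℕ
totient m = length (filter (λ k → gcd k m ≟ 1) (map suc (upTo m)))

Good : ℕ → ℕ → Set
Good m r = 1 ≤ r ×
  (Σ (List ℕ) λ qs → length qs ≡ r × Unique qs × All Prime qs × m ≡ product qs)
  × (∀ p → Prime p → p ∣ totient m → p ∣ m)

-- AC⁰[m] circuits on n inputs as DAGs (straight-line programs).
-- A wire source of a gate with index k is an input variable (Fin n) or
-- an earlier gate (Fin k).  Fan-in lists may repeat sources: this is
-- wire multiplicity.

Src : ℕ → ℕ → Set
Src n k = Fin n ⊎ Fin k

data Gate (n k : ℕ) : Set where
  AND OR MOD : List (Src n k) → Gate n k
  NOT        : Src n k → Gate n k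

data Circuit (n : ℕ) : ℕ → Set where
  []  : Circuit n 0
  _▷_ : ∀ {k} → Circuit n k → Gate n k → Circuit n (suc k)

countTrue : List Bool → ℕ
countTrue = foldr (λ b c → if b then suc c else c) 0

modGate : ℕ → List Bool → Bool
modGate m bs = does (m ∣? countTrue bs)

srcVal : ∀ {n k} → (Fin n → Bool) → Vec Bool k → Src n k → Bool
srcVal x vs (inj₁ i) = x i
srcVal x vs (inj₂ j) = lookup vs j

gateVal : ∀ {n k} → ℕ → (Fin n → Bool) → Vec Bool k → Gate n k → Bool
gateVal m x vs (AND ss) = foldr _∧_ true  (map (srcVal x vs) ss)
gateVal m x vs (OR ss)  = foldr _∨_ false (map (srcVal x vs) ss)
gateVal m x vs (MOD ss) = modGate m (map (srcVal x vs) ss)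
gateVal m x vs (NOT s)  = not (srcVal x vs s)

-- Values of all gates, most recent gate first.  Convention: a source
-- inj₂ j (j : Fin k) of gate number k refers to the j-th earlier gate
-- counting backwards (j = 0 is the immediately preceding gate).
evalAll : ∀ {n k} → ℕ → Circuit n k → (Fin n → Bool) → Vec Bool k
evalAll m []       x = []
evalAll m (c ▷ g)  x = let vs = evalAll m c x in gateVal m x vs g ∷ vs

output : ∀ {n s} → ℕ → Circuit n (suc s) → (Fin n → Bool) → Bool
output m c x = lookup (evalAll m c x) Fin.zero
  where import Data.Fin as Fin

maxL : List ℕ → ℕ
maxL = foldr Data.Nat._⊔_ 0
  where import Data.Nat

srcDepth : ∀ {n k} → Vec ℕ k → Src n k → ℕ
srcDepth ds (inj₁ i) = 0
srcDepth ds (inj₂ j) = lookup ds j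

gateDepth : ∀ {n k} → Vec ℕ k → Gate n k → ℕ
gateDepth ds (AND ss) = suc (maxL (map (srcDepth ds) ss))
gateDepth ds (OR ss)  = suc (maxL (map (srcDepth ds) ss))
gateDepth ds (MOD ss) = suc (maxL (map (srcDepth ds) ss))
gateDepth ds (NOT s)  = suc (srcDepth ds s)

depthAll : ∀ {n k} → Circuit n k → Vec ℕ k
depthAll []      = []
depthAll (c ▷ g) = let ds = depthAll c in gateDepth ds g ∷ ds

depth : ∀ {n s} → Circuit n s → ℕ
depth c = Data.Vec.foldr _ Data.Nat._⊔_ 0 (depthAll c)
  where import Data.Nat ; import Data.Vec

-- Size = number of gates (the index s).

Computes : ∀ {n s} → ℕ → Circuit n (suc s) → ((Fin n → Bool) → Bool) → Set
Computes {n} m c f = ∀ (x : Fin n → Bool) → output m c x ≡ f x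

ones : ∀ {n} → (Fin n → Bool) → ℕ
ones {n} x = countTrue (Data.List.tabulate x)
  where import Data.List

Symmetric : ∀ {n} → ((Fin n → Bool) → Bool) → Set
Symmetric {n} f = ∀ (x y : Fin n → Bool) → ones x ≡ ones y → f x ≡ f y

module Submission where

-- Let d = 3k + 4, D = (r + 3)k + r + 2 and t ≈ n^(1/D), so that depth d should yield size
-- exp(Õ(t)).  Inputs are counted by stages that cost three levels each (OR, AND, then MOD or OR);
-- the first stage handles t^(r+2) inputs, every further stage multiplies this number by t^(r+3).
--
-- A stage splits its input into t superblocks, each consisting of t^(r+2) blocks whose counts the
-- previous stage can test.  For every superblock and every binary digit, the OR guesses the number
-- v of blocks whose count has that digit set, and an AND verifies each guess v = c in two parts.
--
-- (1) v modulo a number ≥ t^r.  For q ∣ m prime and t ≤ q^e, the residue v mod q^e is determined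
--     by the numbers C(v, j) mod q with j < q^e, and C(v, j) counts the satisfied monomials of
--     degree j; each condition is one MOD gate over ANDs of fan-in O(t).
--
-- (2) |v − c| < t^r.  If M elements are counted and M ≤ w·g·t, a random OR–AND–OR–AND formula with
--     bottom fan-in w and size exp(Õ(t)) separates v ≥ c from v ≤ c − g; a union bound over all
--     2^M assignments fixes the random choices.  With g = t^r and w = t this covers t^(r+2)
--     elements, and the bottom AND merges with the top AND of the previous stage.  In the first
--     stage negated inputs would cost a level, so w = 1 is used and one factor t is lost.

-- Neither test suffices alone. Monomials of degree O(t) are few enough for size exp(Õ(t)), but
-- reveal v only modulo about t^r; thresholds of that size blur v by t^r. An error below the modulus
-- is what makes the residue decisive.
--
-- Three levels per stage are possible because negation is free. A stage ends with an OR of ANDs for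
-- an arbitrary predicate g of a count. By De Morgan its negation is an AND of ORs; the outer AND is
-- left open and merges with the ANDs of the next stage, and g being arbitrary, deciding `not ∘ g`
-- is as good as deciding g. NOT gates at inner levels would spoil the level count, so formulas are
-- carried in both polarities, and a negated MOD test becomes an OR of tests for the other residues.
--
-- The number of superblocks is limited by guessing: about K digits for each of t superblocks, every
-- guess being below 2^K with K = O(log n), give exp(Õ(t)) alternatives in all.
--
-- Probabilities are exact counts over finite lists of seeds, and inequalities between probabilities
-- are cleared of denominators.

open import Defs
open import Data.Nat hiding (_%_; _/_)
open import Data.Nat.Properties
open import Data.Nat.DivMod using (_%_; _/_; m≡m%n+[m/n]*n; m%n<n; m/n*n≤m; m/n≤m; n/n≡1; /-monoˡ-≤; m<n⇒m%n≡m; %-distribˡ-+; %-remove-+ʳ)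
open import Data.Nat.Divisibility
open import Data.Nat.ListAction using (product; sum)
open import Data.Nat.ListAction.Properties using (∈⇒∣product)
open import Data.Nat.Logarithm using (⌊log₂_⌋; ⌊log₂⌋-mono-≤; ⌊log₂[2^n]⌋≡n)
open import Data.Nat.Primality using (Prime; prime⇒nonZero; prime⇒nonTrivial; prime⇒irreducible; euclidsLemma; productOfPrimes≢0)
open import Data.Nat.Tactic.RingSolver using (solve-∀)
open import Data.Bool using (Bool; true; false; not; _∧_; _∨_; if_then_else_)
open import Data.Bool.ListAction using (all; any)
open import Data.Bool.Properties using (not-involutive; not-injective; ¬-not; ∧-identityʳ; ∨-identityʳ; ∧-zeroʳ; ∧-assoc; ∨-assoc; ∧-distribˡ-∨; ∧-distribʳ-∨)
open import Data.Empty using (⊥-elim)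
open import Data.Fin using (Fin; zero; suc)
open import Data.List using (List; []; _∷_; _++_; map; length; foldr; replicate; concat; take; drop; lookup; tabulate; allFin; upTo; catMaybes; cartesianProductWith)
open import Data.List.Membership.Propositional using (_∈_)
open import Data.List.Membership.Propositional.Properties using (∈-cartesianProductWith⁺; ∈-upTo⁺; ∈-upTo⁻; ∈-map⁺; ∈-map⁻; ∈-lookup)
open import Data.List.Properties using (length-++; length-map; length-replicate; length-tabulate; length-upTo; length-take; length-drop; take++drop≡id; map-∘; map-tabulate; tabulate-lookup)
open import Data.List.Relation.Unary.All as All using (All; []; _∷_)
import Data.List.Relation.Unary.All.Properties as Allₚ
open import Data.List.Relation.Unary.AllPairs using ([]; _∷_)
open import Data.List.Relation.Unary.Any using (here; there)
open import Data.List.Relation.Unary.Unique.Propositional using (Unique)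
open import Data.Maybe using (Maybe; just; nothing; maybe′)
open import Data.Product using (Σ; ∃; _×_; _,_; proj₁; proj₂)
open import Data.Sum using (inj₁; inj₂)
open import Data.Vec as Vec using (Vec; []; _∷_; toList)
open import Data.Vec.Properties using (length-toList; lookup∘tabulate)
open import Function using (_∘_; const; id)
open import Relation.Binary.PropositionalEquality hiding (J)
open import Relation.Nullary using (¬_; Dec; yes; no; does)

private variable
  A A′ : Set

-- Counting by list enumeration

cnt : (A → Bool) → List A → ℕ
cnt p xs = countTrue (map p xs)

cnt-cong : {p q : A → Bool} → (∀ a → p a ≡ q a) → ∀ xs → cnt p xs ≡ cnt q xs
cnt-cong h []       = refl
cnt-cong h (x ∷ xs) rewrite h x | cnt-cong h xs = refl

cnt-++ : (p : A → Bool) (xs ys : List A) → cnt p (xs ++ ys) ≡ cnt p xs + cnt p ys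
cnt-++ p []       ys = refl
cnt-++ p (x ∷ xs) ys with p x
... | true  = cong suc (cnt-++ p xs ys)
... | false = cnt-++ p xs ys

cnt-map : (p : A′ → Bool) (f : A → A′) (xs : List A) → cnt p (map f xs) ≡ cnt (p ∘ f) xs
cnt-map p f xs = cong countTrue (sym (map-∘ xs))

cnt-false : (xs : List A) → cnt (const false) xs ≡ 0
cnt-false []       = refl
cnt-false (x ∷ xs) = cnt-false xs

cnt-true : (xs : List A) → cnt (const true) xs ≡ length xs
cnt-true []       = refl
cnt-true (x ∷ xs) = cong suc (cnt-true xs)

cnt-replicate : (p : A → Bool) (k : ℕ) (a : A) → cnt p (replicate k a) ≡ (if p a then k else 0)
cnt-replicate p zero    a with p a
... | true  = refl
... | false = refl
cnt-replicate p (suc k) a with p a | cnt-replicate p k a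
... | true  | e = cong suc e
... | false | e = e

cnt+cnt-not : (p : A → Bool) (xs : List A) → cnt p xs + cnt (not ∘ p) xs ≡ length xs
cnt+cnt-not p []       = refl
cnt+cnt-not p (x ∷ xs) with p x
... | true  = cong suc (cnt+cnt-not p xs)
... | false = trans (+-suc _ _) (cong suc (cnt+cnt-not p xs))

cnt≤length : (p : A → Bool) (xs : List A) → cnt p xs ≤ length xs
cnt≤length p xs = subst (cnt p xs ≤_) (cnt+cnt-not p xs) (m≤m+n _ _)

cnt-∨ : (p q : A → Bool) (xs : List A) → cnt (λ a → p a ∨ q a) xs ≤ cnt p xs + cnt q xs
cnt-∨ p q []       = z≤n
cnt-∨ p q (x ∷ xs) with p x | q x
... | true  | true  = s≤s (≤-trans (cnt-∨ p q xs) (+-monoʳ-≤ (cnt p xs) (n≤1+n _)))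
... | true  | false = s≤s (cnt-∨ p q xs)
... | false | true  = ≤-trans (s≤s (cnt-∨ p q xs)) (≤-reflexive (sym (+-suc _ _)))
... | false | false = cnt-∨ p q xs

all-cong : {p q : A → Bool} → (∀ a → p a ≡ q a) → ∀ as → all p as ≡ all q as
all-cong h []       = refl
all-cong h (a ∷ as) = cong₂ _∧_ (h a) (all-cong h as)

any-cong : {p q : A → Bool} → (∀ a → p a ≡ q a) → ∀ as → any p as ≡ any q as
any-cong h []       = refl
any-cong h (a ∷ as) = cong₂ _∨_ (h a) (any-cong h as)

any-not-all : (p : A → Bool) (xs : List A) → any p xs ≡ not (all (not ∘ p) xs)
any-not-all p []       = refl
any-not-all p (x ∷ xs) with p x
... | true  = refl
... | false = any-not-all p xs

-- The sample space of `k` independent uniform draws from `xs`. A probability is `cnt` over this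
-- list divided by its length, and independence is the product formula `cnt-allV`.
tuples : ∀ k → List A → List (Vec A k)
tuples zero    xs = [] ∷ []
tuples (suc k) xs = cartesianProductWith _∷_ xs (tuples k xs)

∈-tuples : {xs : List A} → (∀ a → a ∈ xs) → ∀ {k} (v : Vec A k) → v ∈ tuples k xs
∈-tuples h []      = here refl
∈-tuples h (a ∷ v) = ∈-cartesianProductWith⁺ _∷_ (h a) (∈-tuples h v)

allV anyV : ∀ {k} → (A → Bool) → Vec A k → Bool
allV p v = all p (toList v)
anyV p v = any p (toList v)

cnt-cons : ∀ {k} (p : A → Bool) (xs : List A) (ts : List (Vec A k)) →
  cnt (allV p) (cartesianProductWith _∷_ xs ts) ≡ cnt p xs * cnt (allV p) ts
cnt-cons p []       ts = refl
cnt-cons p (x ∷ xs) ts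
  rewrite cnt-++ (allV p) (map (x ∷_) ts) (cartesianProductWith _∷_ xs ts)
        | cnt-map (allV p) (x ∷_) ts
        | cnt-cons p xs ts
  with p x
... | true  = refl
... | false = cong (_+ cnt p xs * cnt (allV p) ts) (cnt-false ts)

cnt-allV : (p : A → Bool) (xs : List A) → ∀ k → cnt (allV p) (tuples k xs) ≡ cnt p xs ^ k
cnt-allV p xs zero    = refl
cnt-allV p xs (suc k) = trans (cnt-cons p xs (tuples k xs)) (cong (cnt p xs *_) (cnt-allV p xs k))

allV-true : ∀ {k} (v : Vec A k) → allV (const true) v ≡ true
allV-true []      = refl
allV-true (_ ∷ v) = allV-true v

length-tuples : (xs : List A) → ∀ k → length (tuples k xs) ≡ length xs ^ k
length-tuples xs k = begin
  length (tuples k xs)                   ≡⟨ cnt-true (tuples k xs) ⟨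
  cnt (const true) (tuples k xs)         ≡⟨ cnt-cong allV-true (tuples k xs) ⟨
  cnt (allV (const true)) (tuples k xs)  ≡⟨ cnt-allV (const true) xs k ⟩
  cnt (const true) xs ^ k                ≡⟨ cong (_^ k) (cnt-true xs) ⟩
  length xs ^ k                          ∎
  where open ≡-Reasoning

cnt-not : (p : A → Bool) (xs : List A) → cnt (not ∘ p) xs ≡ length xs ∸ cnt p xs
cnt-not p xs = sym (trans (cong (_∸ cnt p xs) (sym (cnt+cnt-not p xs))) (m+n∸m≡n (cnt p xs) _))

cnt-not-anyV : (p : A → Bool) (xs : List A) → ∀ k →
  cnt (not ∘ anyV p) (tuples k xs) ≡ (length xs ∸ cnt p xs) ^ k
cnt-not-anyV p xs k = begin
  cnt (not ∘ anyV p) (tuples k xs)  ≡⟨ cnt-cong (λ v → trans (cong not (any-not-all p (toList v))) (not-involutive _)) (tuples k xs) ⟩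
  cnt (allV (not ∘ p)) (tuples k xs) ≡⟨ cnt-allV (not ∘ p) xs k ⟩
  cnt (not ∘ p) xs ^ k              ≡⟨ cong (_^ k) (cnt-not p xs) ⟩
  (length xs ∸ cnt p xs) ^ k        ∎
  where open ≡-Reasoning

any-false : (p : A → Bool) {xs : List A} {a : A} → a ∈ xs → any p xs ≡ false → p a ≡ false
any-false p {x ∷ xs} (here refl) e with p x
... | false = refl
any-false p {x ∷ xs} (there i)   e with p x
... | false = any-false p i e

cnt<length⇒∃false : (p : A → Bool) (xs : List A) → cnt p xs < length xs → ∃ λ a → p a ≡ false
cnt<length⇒∃false p (x ∷ xs) lt with p x in eq
... | true  = cnt<length⇒∃false p xs (s≤s⁻¹ lt)
... | false = x , eq

union-bound : (bad : A → A′ → Bool) (ys : List A) (ω : List A′) →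
  (∀ y → cnt (bad y) ω * length ys < length ω) → 0 < length ys →
  ∃ λ s → ∀ {y} → y ∈ ys → bad y s ≡ false
union-bound bad ys ω h pos with cnt<length⇒∃false (λ s → any (λ y → bad y s) ys) ω lt
  where
  P W : ℕ
  P = length ys
  W = length ω
  -- The summand `length zs` collects one unit from each strict inequality; for `zs = ys` it makes
  -- the final bound strict.
  total : ∀ zs → cnt (λ s → any (λ y → bad y s) zs) ω * P + length zs ≤ length zs * W
  total []       = ≤-reflexive (trans (+-identityʳ _) (cong (_* P) (cnt-false ω)))
  total (z ∷ zs) = begin
    cnt (λ s → bad z s ∨ r s) ω * P + suc (length zs)          ≤⟨ +-monoˡ-≤ _ (*-monoˡ-≤ P (cnt-∨ (bad z) r ω)) ⟩
    (cnt (bad z) ω + cnt r ω) * P + suc (length zs)            ≡⟨ lem (cnt (bad z) ω) (cnt r ω) P (length zs) ⟩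
    suc (cnt (bad z) ω * P) + (cnt r ω * P + length zs)        ≤⟨ +-mono-≤ (h z) (total zs) ⟩
    W + length zs * W                                          ∎
    where
    open ≤-Reasoning
    r : _ → Bool
    r s = any (λ y → bad y s) zs
    lem : ∀ a b c d → (a + b) * c + suc d ≡ suc (a * c) + (b * c + d)
    lem = solve-∀
  lt : cnt (λ s → any (λ y → bad y s) ys) ω < W
  lt = *-cancelˡ-< P _ W (≤-trans (≤-trans (s≤s (≤-reflexive (*-comm P _))) (≤-trans (≤-reflexive (+-comm 1 _)) (+-monoʳ-≤ _ pos))) (total ys))
... | s , e = s , λ i → any-false (λ y → bad y s) i e

-- Bernoulli's inequality without division

^-distribʳ-* : ∀ a b k → (a * b) ^ k ≡ a ^ k * b ^ k
^-distribʳ-* a b zero    = refl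
^-distribʳ-* a b (suc k) rewrite ^-distribʳ-* a b k = lem a b (a ^ k) (b ^ k)
  where
  lem : ∀ a b c d → a * b * (c * d) ≡ a * c * (b * d)
  lem = solve-∀

-- With X = x + y this is (1 - y/X)^k ≥ 1 - ky/X, multiplied by X^(k+1).
bernoulli-upper : ∀ x y k → (x + y) ^ k * (x + y) ≤ x ^ k * (x + y) + k * y * (x + y) ^ k
bernoulli-upper x y zero    = m≤m+n _ _
bernoulli-upper x y (suc k) = begin
  X * X ^ k * X                                          ≡⟨ l₁ X (X ^ k) ⟩
  X * (X ^ k * X)                                        ≤⟨ *-monoʳ-≤ X (bernoulli-upper x y k) ⟩
  X * (x ^ k * X + k * y * X ^ k)                        ≡⟨ l₂ x y (x ^ k) (X ^ k) k ⟩
  x * x ^ k * X + (x ^ k * (y * X) + k * y * (X * X ^ k)) ≤⟨ +-monoʳ-≤ (x * x ^ k * X) (+-monoˡ-≤ _ (*-monoˡ-≤ (y * X) (^-monoˡ-≤ k (m≤m+n x y)))) ⟩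
  x * x ^ k * X + (X ^ k * (y * X) + k * y * (X * X ^ k)) ≡⟨ l₃ x y (x ^ k) (X ^ k) k ⟩
  x * x ^ k * X + suc k * y * (X * X ^ k)                ∎
  where
  open ≤-Reasoning
  X : ℕ
  X = x + y
  l₁ : ∀ X p → X * p * X ≡ X * (p * X)
  l₁ = solve-∀
  l₂ : ∀ x y p q k → (x + y) * (p * (x + y) + k * y * q) ≡ x * p * (x + y) + (p * (y * (x + y)) + k * y * ((x + y) * q))
  l₂ = solve-∀
  l₃ : ∀ x y p q k → x * p * (x + y) + (q * (y * (x + y)) + k * y * ((x + y) * q)) ≡ x * p * (x + y) + suc k * y * ((x + y) * q)
  l₃ = solve-∀

-- This is (1 + y/x)^k ≥ 1 + ky/x, multiplied by x^(k+1).
bernoulli-lower : ∀ x y k → x ^ k * (x + k * y) ≤ x * (x + y) ^ k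
bernoulli-lower x y zero    = ≤-reflexive (l x y)
  where
  l : ∀ x y → 1 * (x + 0 * y) ≡ x * 1
  l = solve-∀
bernoulli-lower x y (suc k) = begin
  x * x ^ k * (x + suc k * y)                      ≡⟨ l₁ x y (x ^ k) k ⟩
  x * (x ^ k * (x + k * y)) + x ^ k * (x * y)       ≤⟨ +-mono-≤ (*-monoʳ-≤ x (bernoulli-lower x y k)) (*-monoˡ-≤ (x * y) (^-monoˡ-≤ k (m≤m+n x y))) ⟩
  x * (x * (x + y) ^ k) + (x + y) ^ k * (x * y)     ≡⟨ l₂ x y ((x + y) ^ k) ⟩
  x * ((x + y) * (x + y) ^ k)                      ∎
  where
  open ≤-Reasoning
  l₁ : ∀ x y p k → x * p * (x + suc k * y) ≡ x * (p * (x + k * y)) + p * (x * y)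
  l₁ = solve-∀
  l₂ : ∀ x y q → x * (x * q) + q * (x * y) ≡ x * ((x + y) * q)
  l₂ = solve-∀

2*n≡n+n : ∀ n → 2 * n ≡ n + n
2*n≡n+n n = cong (n +_) (+-identityʳ n)

-- For p = y/(x + y), an event of probability p fails to occur in k trials with probability at least
-- 1/2 if kp ≤ 1/2; `power-doubles` bounds the same probability by 1/2 from above if kp ≥ 1.
-- Together they govern how many repetitions are allowed and how many are needed.
power-at-most-doubles : ∀ x y k → 0 < x + y → 2 * (k * y) ≤ x + y → (x + y) ^ k ≤ 2 * x ^ k
power-at-most-doubles x y k pos h = *-cancelʳ-≤ _ _ X {{>-nonZero pos}} (+-cancelʳ-≤ (X ^ k * X) _ _ (begin
  X ^ k * X + X ^ k * X                          ≡⟨ 2*n≡n+n (X ^ k * X) ⟨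
  2 * (X ^ k * X)                                ≤⟨ *-monoʳ-≤ 2 (bernoulli-upper x y k) ⟩
  2 * (x ^ k * X + k * y * X ^ k)                ≡⟨ l (x ^ k) X (k * y) (X ^ k) ⟩
  2 * x ^ k * X + X ^ k * (2 * (k * y))          ≤⟨ +-monoʳ-≤ (2 * x ^ k * X) (*-monoʳ-≤ (X ^ k) h) ⟩
  2 * x ^ k * X + X ^ k * X                      ∎))
  where
  open ≤-Reasoning
  X : ℕ
  X = x + y
  l : ∀ p X q r → 2 * (p * X + q * r) ≡ 2 * p * X + r * (2 * q)
  l = solve-∀

power-doubles : ∀ x y k → 0 < x + y → x + y ≤ k * y → 2 * x ^ k ≤ (x + y) ^ k
power-doubles zero    y zero    pos h = ⊥-elim (<-irrefl refl (≤-trans pos h))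
power-doubles zero    y (suc k) pos h = z≤n
power-doubles x@(suc _) y k pos h = *-cancelˡ-≤ x (begin
  x * (2 * x ^ k)          ≡⟨ l x (x ^ k) ⟩
  x ^ k * (x + x)          ≤⟨ *-monoʳ-≤ (x ^ k) (+-monoʳ-≤ x (≤-trans (m≤m+n x y) h)) ⟩
  x ^ k * (x + k * y)      ≤⟨ bernoulli-lower x y k ⟩
  x * (x + y) ^ k          ∎)
  where
  open ≤-Reasoning
  l : ∀ x p → x * (2 * p) ≡ p * (x + x)
  l = solve-∀

^-mono-scaled : ∀ a b c k j → a * b ^ k ≤ c ^ k → a ^ j * b ^ (k * j) ≤ c ^ (k * j)
^-mono-scaled a b c k j h = begin
  a ^ j * b ^ (k * j)   ≡⟨ cong (a ^ j *_) (^-*-assoc b k j) ⟨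
  a ^ j * (b ^ k) ^ j   ≡⟨ ^-distribʳ-* a (b ^ k) j ⟨
  (a * b ^ k) ^ j       ≤⟨ ^-monoˡ-≤ j h ⟩
  (c ^ k) ^ j           ≡⟨ ^-*-assoc c k j ⟩
  c ^ (k * j)           ∎
  where open ≤-Reasoning

^-mono-scaledʳ : ∀ a b c k j → c ^ k ≤ a * b ^ k → c ^ (k * j) ≤ a ^ j * b ^ (k * j)
^-mono-scaledʳ a b c k j h = begin
  c ^ (k * j)           ≡⟨ ^-*-assoc c k j ⟨
  (c ^ k) ^ j           ≤⟨ ^-monoˡ-≤ j h ⟩
  (a * b ^ k) ^ j       ≡⟨ ^-distribʳ-* a (b ^ k) j ⟩
  a ^ j * (b ^ k) ^ j   ≡⟨ cong (a ^ j *_) (^-*-assoc b k j) ⟩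
  a ^ j * b ^ (k * j)   ∎
  where open ≤-Reasoning

record Ceil (x y : ℕ) : Set where
  field
    q      : ℕ
    above  : x ≤ q * y
    below  : q * y ≤ x + y
    q≤     : q ≤ suc x

ceil : ∀ x y → 0 < y → Ceil x y
ceil x y@(suc _) pos = record
  { q = suc (x / y)
  ; above = ≤-trans (≤-reflexive (m≡m%n+[m/n]*n x y)) (+-monoˡ-≤ _ (<⇒≤ (m%n<n x y)))
  ; below = ≤-trans (≤-reflexive (+-comm y _)) (+-monoˡ-≤ y (m/n*n≤m x y))
  ; q≤ = s≤s (m/n≤m x y)
  }

-- Probabilistic separation of counts

^-positive : ∀ x k → 0 < x → 0 < x ^ k
^-positive x k pos = m^n>0 x {{>-nonZero pos}} k

-- A random atom is one of M₀, of which a accept at the lower and a + δ at the upper threshold.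
-- K atoms are joined by an OR, B of these by an AND.
module Amplifier
  (M₀ a δ t Z ζ : ℕ)
  (2a≤M₀ : 2 * a ≤ M₀) (b≤M₀ : a + δ ≤ M₀) (0<δ : 0 < δ) (a≤tδ : a ≤ t * δ)
  (4Z≤2^ζ : 4 * Z ≤ 2 ^ ζ) where

  open Ceil (ceil M₀ δ 0<δ) renaming (q to h₀; above to M₀≤h₀δ; below to h₀δ≤M₀+δ; q≤ to h₀≤sM₀) public

  -- `G` counts all ORs of `K` atoms, `lo` and `hi` those that reject at the lower and at the upper
  -- threshold. As `h₀` is about M₀/δ, every `h₀` atoms at least halve the ratio hi/lo, so `ζ`
  -- batches bring it down to 2^-ζ. `V` bounds log₂(G/lo).
  K G lo hi V : ℕ
  K  = h₀ * ζ
  G  = M₀ ^ K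
  lo = (M₀ ∸ a) ^ K
  hi = (M₀ ∸ (a + δ)) ^ K
  V  = 8 * ζ * t

  a≤M₀ : a ≤ M₀
  a≤M₀ = ≤-trans (m≤m+n a δ) b≤M₀

  M₀-split : (M₀ ∸ (a + δ)) + δ ≡ M₀ ∸ a
  M₀-split = trans (cong (_+ δ) (sym (∸-+-assoc M₀ a δ))) (m∸n+n≡m (m+n≤o⇒m≤o∸n δ (≤-trans (≤-reflexive (+-comm δ a)) b≤M₀)))

  0<M₀∸a : 0 < M₀ ∸ a
  0<M₀∸a = ≤-trans (≤-trans 0<δ (m≤n+m δ _)) (≤-reflexive M₀-split)

  0<M₀ : 0 < M₀
  0<M₀ = ≤-trans 0<M₀∸a (m∸n≤m M₀ a)

  0<lo : 0 < lo
  0<lo = ^-positive _ K 0<M₀∸a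

  0<G : 0 < G
  0<G = ^-positive _ K 0<M₀

  lo≤G : lo ≤ G
  lo≤G = ^-monoˡ-≤ K (m∸n≤m M₀ a)

  4Zhi≤lo : 4 * Z * hi ≤ lo
  4Zhi≤lo = ≤-trans (*-monoˡ-≤ hi 4Z≤2^ζ) (subst (λ x → 2 ^ ζ * hi ≤ x ^ K) M₀-split
    (^-mono-scaled 2 x (x + δ) h₀ ζ (power-doubles x δ h₀ (≤-trans 0<δ (m≤n+m δ x))
      (≤-trans (≤-reflexive M₀-split) (≤-trans (m∸n≤m M₀ a) M₀≤h₀δ)))))
    where
    x : ℕ
    x = M₀ ∸ (a + δ)

  -- At the lower threshold an OR has about Ka/M₀ accepting atoms on average, which is O(ζt) because
  -- K is about ζM₀/δ and a ≤ tδ. Hence it still rejects with probability 2^-O(ζt). For a = 0 it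
  -- always rejects.
  G≤2^V*lo : G ≤ 2 ^ V * lo
  G≤2^V*lo = go a refl
    where
    open ≤-Reasoning
    go : ∀ a′ → a ≡ a′ → G ≤ 2 ^ V * lo
    go zero      eq = ≤-trans (≤-reflexive (cong (λ z → (M₀ ∸ z) ^ K) (sym eq))) (≤-trans (≤-reflexive (sym (*-identityˡ lo))) (*-monoˡ-≤ lo (^-positive 2 V (s≤s z≤n))))
    -- A group of h = M₀/(2a) atoms rejects with probability at least 1/2. `K` need not be a
    -- multiple of h, so the exponent is padded to N = hV and the padding cancelled. The 8 in `V` is
    -- 2 for the rounding of `h₀` times 4 from M₀ ≤ 4ha.
    go a′@(suc _) eq = *-cancelʳ-≤ _ _ (x ^ (N ∸ K)) {{>-nonZero (^-positive x (N ∸ K) 0<x)}} (begin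
      M₀ ^ K * x ^ (N ∸ K)        ≤⟨ *-monoʳ-≤ (M₀ ^ K) (^-monoˡ-≤ (N ∸ K) (m∸n≤m M₀ a′)) ⟩
      M₀ ^ K * M₀ ^ (N ∸ K)       ≡⟨ ^-distribˡ-+-* M₀ K (N ∸ K) ⟨
      M₀ ^ (K + (N ∸ K))          ≡⟨ cong (M₀ ^_) (m+[n∸m]≡n K≤N) ⟩
      M₀ ^ N                      ≤⟨ ^-mono-scaledʳ 2 x M₀ h V step ⟩
      2 ^ V * x ^ N               ≡⟨ cong (λ z → 2 ^ V * x ^ z) (m+[n∸m]≡n K≤N) ⟨
      2 ^ V * x ^ (K + (N ∸ K))   ≡⟨ cong (2 ^ V *_) (^-distribˡ-+-* x K (N ∸ K)) ⟩
      2 ^ V * (x ^ K * x ^ (N ∸ K)) ≡⟨ *-assoc (2 ^ V) (x ^ K) _ ⟨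
      2 ^ V * x ^ K * x ^ (N ∸ K) ≡⟨ cong (λ z → 2 ^ V * (M₀ ∸ z) ^ K * x ^ (N ∸ K)) eq ⟨
      2 ^ V * lo * x ^ (N ∸ K)    ∎)
      where
      h N x : ℕ
      h = M₀ / (2 * a′)
      N = h * V
      x = M₀ ∸ a′
      0<x : 0 < x
      0<x = subst (λ z → 0 < M₀ ∸ z) eq 0<M₀∸a
      2a′≤M₀ : 2 * a′ ≤ M₀
      2a′≤M₀ = subst (λ z → 2 * z ≤ M₀) eq 2a≤M₀
      a′≤M₀ : a′ ≤ M₀
      a′≤M₀ = subst (_≤ M₀) eq a≤M₀
      x+a′ : x + a′ ≡ M₀
      x+a′ = m∸n+n≡m a′≤M₀
      step : M₀ ^ h ≤ 2 * x ^ h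
      step = subst (λ z → z ^ h ≤ 2 * x ^ h) x+a′ (power-at-most-doubles x a′ h (≤-trans 0<x (m≤m+n x a′))
        (begin
          2 * (h * a′)   ≡⟨ l h a′ ⟩
          h * (2 * a′)   ≤⟨ m/n*n≤m M₀ (2 * a′) ⟩
          M₀             ≡⟨ x+a′ ⟨
          x + a′         ∎))
        where
        l : ∀ h a → 2 * (h * a) ≡ h * (2 * a)
        l = solve-∀
      M₀≤4ha′ : M₀ ≤ 4 * (h * a′)
      M₀≤4ha′ = begin
        M₀                           ≡⟨ m≡m%n+[m/n]*n M₀ (2 * a′) ⟩
        M₀ % (2 * a′) + h * (2 * a′) ≤⟨ +-monoˡ-≤ _ (<⇒≤ (m%n<n M₀ (2 * a′))) ⟩
        2 * a′ + h * (2 * a′)        ≤⟨ +-monoˡ-≤ _ (≤-trans (≤-reflexive (sym (*-identityˡ (2 * a′)))) (*-monoˡ-≤ (2 * a′) 1≤h)) ⟩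
        h * (2 * a′) + h * (2 * a′)  ≡⟨ l h a′ ⟩
        4 * (h * a′)                 ∎
        where
        1≤h : 1 ≤ h
        1≤h = ≤-trans (≤-reflexive (sym (n/n≡1 (2 * a′)))) (/-monoˡ-≤ (2 * a′) 2a′≤M₀)
        l : ∀ h a → h * (2 * a) + h * (2 * a) ≡ 4 * (h * a)
        l = solve-∀
      h₀≤8th : h₀ ≤ 8 * t * h
      h₀≤8th = *-cancelʳ-≤ h₀ (8 * t * h) δ {{>-nonZero 0<δ}} (begin
        h₀ * δ                 ≤⟨ h₀δ≤M₀+δ ⟩
        M₀ + δ                 ≤⟨ +-monoʳ-≤ M₀ (≤-trans (m≤n+m δ a) b≤M₀) ⟩
        M₀ + M₀                ≤⟨ +-mono-≤ M₀≤4ha′ M₀≤4ha′ ⟩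
        4 * (h * a′) + 4 * (h * a′) ≤⟨ +-mono-≤ m m ⟩
        4 * (h * (t * δ)) + 4 * (h * (t * δ)) ≡⟨ l h t δ ⟩
        8 * t * h * δ          ∎)
        where
        m : 4 * (h * a′) ≤ 4 * (h * (t * δ))
        m = *-monoʳ-≤ 4 (*-monoʳ-≤ h (subst (_≤ t * δ) eq a≤tδ))
        l : ∀ h t d → 4 * (h * (t * d)) + 4 * (h * (t * d)) ≡ 8 * t * h * d
        l = solve-∀
      K≤N : K ≤ N
      K≤N = ≤-trans (*-monoˡ-≤ ζ h₀≤8th) (≤-reflexive (l t h ζ))
        where
        l : ∀ t h z → 8 * t * h * z ≡ h * (8 * z * t)
        l = solve-∀

  open Ceil (ceil G lo 0<lo) renaming (q to b₁; above to G≤b₁lo; below to b₁lo≤G+lo; q≤ to b₁≤sG) public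

  -- `b₁` is about G/lo: the AND of `b₁` ORs accepts at the lower threshold with probability at most
  -- 1/2, and `Z` batches reach 2^-Z. At the upper threshold the expected number of rejecting ORs,
  -- B·hi/G, is still at most 1/2, because hi is at most lo/(4Z).
  B : ℕ
  B = b₁ * Z

  b₁≤ : b₁ ≤ 2 ^ suc V
  b₁≤ = *-cancelʳ-≤ b₁ (2 ^ suc V) lo {{>-nonZero 0<lo}} (begin
    b₁ * lo                ≤⟨ b₁lo≤G+lo ⟩
    G + lo                 ≤⟨ +-monoʳ-≤ G lo≤G ⟩
    G + G                  ≤⟨ +-mono-≤ G≤2^V*lo G≤2^V*lo ⟩
    2 ^ V * lo + 2 ^ V * lo ≡⟨ l (2 ^ V) lo ⟩
    2 ^ suc V * lo         ∎)
    where
    open ≤-Reasoning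
    l : ∀ p q → p * q + p * q ≡ 2 * p * q
    l = solve-∀

  2Bhi≤G : 2 * (B * hi) ≤ G
  2Bhi≤G = *-cancelʳ-≤ _ _ lo {{>-nonZero 0<lo}} (begin
    2 * (b₁ * Z * hi) * lo    ≡⟨ l₁ b₁ Z hi lo ⟩
    2 * (Z * hi) * (b₁ * lo)  ≤⟨ *-monoʳ-≤ (2 * (Z * hi)) (≤-trans b₁lo≤G+lo (+-monoʳ-≤ G lo≤G)) ⟩
    2 * (Z * hi) * (G + G)    ≡⟨ l₂ Z hi G ⟩
    G * (4 * Z * hi)          ≤⟨ *-monoʳ-≤ G 4Zhi≤lo ⟩
    G * lo                    ∎)
    where
    open ≤-Reasoning
    l₁ : ∀ b z h l → 2 * (b * z * h) * l ≡ 2 * (z * h) * (b * l)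
    l₁ = solve-∀
    l₂ : ∀ z h g → 2 * (z * h) * (g + g) ≡ g * (4 * z * h)
    l₂ = solve-∀

  -- Of the G possible ORs of atoms, R reject.
  low-accepts : ∀ R → lo ≤ R → R ≤ G → 2 ^ Z * (G ∸ R) ^ B ≤ G ^ B
  low-accepts R lo≤R R≤G = subst (λ g → 2 ^ Z * (G ∸ R) ^ B ≤ g ^ B) (m∸n+n≡m R≤G)
    (^-mono-scaled 2 (G ∸ R) (G ∸ R + R) b₁ Z (power-doubles (G ∸ R) R b₁
      (subst (0 <_) (sym (m∸n+n≡m R≤G)) 0<G)
      (subst (_≤ b₁ * R) (sym (m∸n+n≡m R≤G)) (≤-trans G≤b₁lo (*-monoʳ-≤ b₁ lo≤R)))))

  high-accepts : ∀ R → R ≤ hi → R ≤ G → G ^ B ≤ 2 * (G ∸ R) ^ B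
  high-accepts R R≤hi R≤G = subst (λ g → g ^ B ≤ 2 * (G ∸ R) ^ B) (m∸n+n≡m R≤G)
    (power-at-most-doubles (G ∸ R) R B
      (subst (0 <_) (sym (m∸n+n≡m R≤G)) 0<G)
      (subst (2 * (B * R) ≤_) (sym (m∸n+n≡m R≤G)) (≤-trans (*-monoʳ-≤ 2 (*-monoʳ-≤ B R≤hi)) 2Bhi≤G)))

suc≤2^ : ∀ k → suc k ≤ 2 ^ k
suc≤2^ zero    = ≤-refl
suc≤2^ (suc k) = ≤-trans (+-mono-≤ (m^n>0 2 k) (suc≤2^ k)) (+-monoʳ-≤ (2 ^ k) (≤-reflexive (sym (+-identityʳ (2 ^ k)))))

-- The top OR has M + 1 rows. If a row accepts with probability at least 1/2, all rows reject with
-- probability at most 2^-(M+1). If a row accepts with probability at most 2^-(2M+1), some row does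
-- so with probability at most (M + 1)·2^-(2M+1) ≤ 2^-(M+1). Both beat a union bound over 2^M
-- assignments, and the second dictates Z = 2M + 1.
module Cover (M X : ℕ) (0<X : 0 < X) where

  private
    rounds : ℕ
    rounds = suc M

    2e≤y⇒e<y : ∀ e {y} → 0 < y → 2 * e ≤ y → e < y
    2e≤y⇒e<y zero    pos h = pos
    2e≤y⇒e<y (suc e) pos h = ≤-trans (s≤s (≤-trans (m≤n+m (suc e) e) (≤-reflexive (cong (e +_) (sym (+-identityʳ (suc e))))))) h

  low-bad : ∀ acc → acc ≤ X → 2 ^ (2 * M + 1) * acc ≤ X → (X ^ rounds ∸ (X ∸ acc) ^ rounds) * 2 ^ M < X ^ rounds
  low-bad acc acc≤X h = 2e≤y⇒e<y _ (^-positive X rounds 0<X) (*-cancelʳ-≤ _ _ X {{>-nonZero 0<X}} (begin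
    2 * (D * 2 ^ M) * X                     ≡⟨ l₁ D (2 ^ M) X ⟩
    2 * 2 ^ M * (D * X)                     ≤⟨ *-monoʳ-≤ (2 * 2 ^ M) DX≤ ⟩
    2 * 2 ^ M * (rounds * acc * X ^ rounds)           ≤⟨ *-monoʳ-≤ (2 * 2 ^ M) (*-monoˡ-≤ (X ^ rounds) (*-monoˡ-≤ acc (suc≤2^ M))) ⟩
    2 * 2 ^ M * (2 ^ M * acc * X ^ rounds)       ≡⟨ l₂ (2 ^ M) acc (X ^ rounds) ⟩
    2 ^ M * 2 ^ M * 2 * acc * X ^ rounds         ≡⟨ cong (λ z → z * acc * X ^ rounds) 2^[2M+1] ⟨
    2 ^ (2 * M + 1) * acc * X ^ rounds           ≤⟨ *-monoˡ-≤ (X ^ rounds) h ⟩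
    X * X ^ rounds                               ≡⟨ *-comm X (X ^ rounds) ⟩
    X ^ rounds * X                               ∎))
    where
    open ≤-Reasoning
    D : ℕ
    D = X ^ rounds ∸ (X ∸ acc) ^ rounds
    split : X ∸ acc + acc ≡ X
    split = m∸n+n≡m acc≤X
    DX≤ : D * X ≤ rounds * acc * X ^ rounds
    DX≤ = ≤-trans (≤-reflexive (*-distribʳ-∸ X (X ^ rounds) ((X ∸ acc) ^ rounds)))
      (m≤n+o⇒m∸n≤o (X ^ rounds * X) ((X ∸ acc) ^ rounds * X)
        (subst (λ z → z ^ rounds * z ≤ (X ∸ acc) ^ rounds * z + rounds * acc * z ^ rounds) split (bernoulli-upper (X ∸ acc) acc rounds)))
    2^[2M+1] : 2 ^ (2 * M + 1) ≡ 2 ^ M * 2 ^ M * 2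
    2^[2M+1] = trans (^-distribˡ-+-* 2 (2 * M) 1) (cong (_* 2) (trans (cong (2 ^_) (2*n≡n+n M)) (^-distribˡ-+-* 2 M M)))
    l₁ : ∀ d p x → 2 * (d * p) * x ≡ 2 * p * (d * x)
    l₁ = solve-∀
    l₂ : ∀ p a x → 2 * p * (p * a * x) ≡ p * p * 2 * a * x
    l₂ = solve-∀

  high-bad : ∀ acc → X ≤ 2 * acc → (X ∸ acc) ^ rounds * 2 ^ M < X ^ rounds
  high-bad acc h = 2e≤y⇒e<y _ (^-positive X rounds 0<X) (begin
    2 * ((X ∸ acc) ^ rounds * 2 ^ M)   ≡⟨ l ((X ∸ acc) ^ rounds) (2 ^ M) ⟩
    2 ^ rounds * (X ∸ acc) ^ rounds         ≡⟨ ^-distribʳ-* 2 (X ∸ acc) rounds ⟨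
    (2 * (X ∸ acc)) ^ rounds           ≤⟨ ^-monoˡ-≤ rounds 2[X∸acc]≤X ⟩
    X ^ rounds                         ∎)
    where
    open ≤-Reasoning
    l : ∀ p q → 2 * (p * q) ≡ 2 * q * p
    l = solve-∀
    2[X∸acc]≤X : 2 * (X ∸ acc) ≤ X
    2[X∸acc]≤X = ≤-trans (≤-reflexive (*-distribˡ-∸ 2 X acc))
      (m≤n+o⇒m∸n≤o (2 * X) (2 * acc) (≤-trans (≤-reflexive (2*n≡n+n X)) (+-monoˡ-≤ X h)))

-- A tuple stands for the AND of its `w` entries, drawn with repetition so that S true variables
-- satisfy exactly S^w tuples; `nothing` never accepts.
Atom : ℕ → ℕ → Set
Atom M w = Maybe (Vec (Fin M) w)

Seed : (M w K B A : ℕ) → Set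
Seed M w K B A = Vec (Vec (Vec (Atom M w) K) B) A

acceptsAtom : ∀ {M w} → (Fin M → Bool) → Atom M w → Bool
acceptsAtom y = maybe′ (allV y) false

accepts : ∀ {M w K B A} → (Fin M → Bool) → Seed M w K B A → Bool
accepts y = anyV (allV (anyV (acceptsAtom y)))

accepts-cong : ∀ {M w K B A} {y z : Fin M → Bool} → (∀ i → y i ≡ z i) → (s : Seed M w K B A) → accepts y s ≡ accepts z s
accepts-cong {y = y} {z} h s = any-cong (λ row → all-cong (λ a → any-cong atom (toList a)) (toList row)) (toList s)
  where
  atom : ∀ a → acceptsAtom y a ≡ acceptsAtom z a
  atom (just v) = all-cong h (toList v)
  atom nothing  = refl

record Separator (M w g c K B : ℕ) : Set where
  field
    seed    : Seed M w K B (suc M)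
    complete : ∀ y → c ≤ cnt y (allFin M) → accepts y seed ≡ true
    sound    : ∀ y → cnt y (allFin M) + g ≤ c → accepts y seed ≡ false

-- The atoms widen the relative gap: for x = c - g, Bernoulli gives (c/x)^w ≥ 1 + wg/x ≥ 1 + 1/t,
-- since x ≤ M ≤ wgt. This is the condition a ≤ tδ of the amplifier, with a and a + δ the numbers of
-- accepting atoms for counts c - g and c.
separator-exists : ∀ M w t g c ζ → 0 < w → 0 < g → g ≤ c → c ≤ M → M ≤ w * g * t → 4 * (2 * M + 1) ≤ 2 ^ ζ →
  ∃ λ K → ∃ λ B → K ≤ suc (2 * M ^ w) * ζ × B ≤ 2 ^ suc (8 * ζ * t) * (2 * M + 1) × Separator M w g c K B
separator-exists M w t g c ζ 0<w 0<g g≤c c≤M M≤wgt 4Z≤2^ζ =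
  K , B , *-monoˡ-≤ ζ h₀≤sM₀ , *-monoˡ-≤ Z b₁≤ , record
    { seed     = seed
    ; complete = λ y c≤S → trans (accepts-cong (λ i → sym (table y i)) seed)
        (complete′ (assignment y) (≤-trans c≤S (≤-reflexive (cnt-cong (λ i → sym (table y i)) (allFin M)))))
    ; sound    = λ y S+g≤c → trans (accepts-cong (λ i → sym (table y i)) seed)
        (sound′ (assignment y) (≤-trans (≤-reflexive (cong (_+ g) (cnt-cong (table y) (allFin M)))) S+g≤c))
    }
  where
  M₀ a δ Z : ℕ
  M₀ = 2 * M ^ w
  a  = (c ∸ g) ^ w
  δ  = c ^ w ∸ a
  Z  = 2 * M + 1

  a≤c^w : a ≤ c ^ w
  a≤c^w = ^-monoˡ-≤ w (m∸n≤m c g)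

  a+δ : a + δ ≡ c ^ w
  a+δ = m+[n∸m]≡n a≤c^w

  0<δ : 0 < δ
  0<δ = m<n⇒0<n∸m (^-monoˡ-< w {{>-nonZero 0<w}} (∸-monoʳ-< {c} 0<g g≤c))

  a≤tδ : a ≤ t * δ
  a≤tδ = ≤-trans (m+n≤o⇒m≤o∸n a (go (c ∸ g) (m∸n+n≡m g≤c)))
                 (≤-reflexive (sym (*-distribˡ-∸ t (c ^ w) a)))
    where
    go : ∀ x → x + g ≡ c → x ^ w + t * x ^ w ≤ t * c ^ w
    go zero    e = ≤-trans (≤-reflexive (trans (cong (λ z → z + t * z) 0^w) (*-zeroʳ t))) z≤n
      where
      0^w : 0 ^ w ≡ 0
      0^w = n≤0⇒n≡0 (s≤s⁻¹ (subst (0 ^ w <_) (^-zeroˡ w) (^-monoˡ-< w {{>-nonZero 0<w}} (s≤s (z≤n {0})))))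
    go x@(suc _) e = *-cancelˡ-≤ x (begin
      x * (x ^ w + t * x ^ w)                  ≡⟨ l₁ x (x ^ w) t ⟩
      x ^ w * x + t * (x ^ w * x)              ≤⟨ +-monoˡ-≤ _ (*-monoʳ-≤ (x ^ w) x≤wgt) ⟩
      x ^ w * (w * g * t) + t * (x ^ w * x)    ≡⟨ l₂ x (x ^ w) t w g ⟩
      t * (x ^ w * (x + w * g))                ≤⟨ *-monoʳ-≤ t (bernoulli-lower x g w) ⟩
      t * (x * (x + g) ^ w)                    ≡⟨ cong (λ z → t * (x * z ^ w)) e ⟩
      t * (x * c ^ w)                          ≡⟨ l₃ t x (c ^ w) ⟩
      x * (t * c ^ w)                          ∎)
      where
      open ≤-Reasoning
      x≤wgt : x ≤ w * g * t
      x≤wgt = ≤-trans (≤-trans (m≤m+n x g) (≤-reflexive e)) (≤-trans c≤M M≤wgt)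
      l₁ : ∀ x p t → x * (p + t * p) ≡ p * x + t * (p * x)
      l₁ = solve-∀
      l₂ : ∀ x p t w g → p * (w * g * t) + t * (p * x) ≡ t * (p * (x + w * g))
      l₂ = solve-∀
      l₃ : ∀ t x p → t * (x * p) ≡ x * (t * p)
      l₃ = solve-∀

  2a≤M₀ : 2 * a ≤ M₀
  2a≤M₀ = *-monoʳ-≤ 2 (^-monoˡ-≤ w (≤-trans (m∸n≤m c g) c≤M))

  b≤M₀ : a + δ ≤ M₀
  b≤M₀ = ≤-trans (≤-reflexive a+δ) (≤-trans (^-monoˡ-≤ w c≤M) (m≤m+n (M ^ w) _))

  open Amplifier M₀ a δ t Z ζ 2a≤M₀ b≤M₀ 0<δ a≤tδ 4Z≤2^ζ

  X : ℕ
  X = G ^ B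

  open Cover M X (^-positive G B 0<G)

  -- The atoms that never accept keep the acceptance probability of a random atom at most 1/2.
  atoms : List (Atom M w)
  atoms = map just (tuples w (allFin M)) ++ replicate (M ^ w) nothing

  ω₁ : List (Vec (Atom M w) K)
  ω₁ = tuples K atoms

  ω₂ : List (Vec (Vec (Atom M w) K) B)
  ω₂ = tuples B ω₁

  ω₃ : List (Seed M w K B (suc M))
  ω₃ = tuples (suc M) ω₂

  length-allFin : length (allFin M) ≡ M
  length-allFin = length-tabulate {n = M} (λ i → i)

  length-atoms : length atoms ≡ M₀
  length-atoms = begin
    length atoms                          ≡⟨ length-++ (map just (tuples w (allFin M))) ⟩
    length (map just (tuples w (allFin M))) + length (replicate (M ^ w) nothing)
      ≡⟨ cong₂ _+_ (trans (length-map just (tuples w (allFin M))) (trans (length-tuples (allFin M) w) (cong (_^ w) length-allFin))) (length-replicate (M ^ w)) ⟩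
    M ^ w + M ^ w                         ≡⟨ 2*n≡n+n (M ^ w) ⟨
    2 * M ^ w                             ∎
    where open ≡-Reasoning

  length-ω₁ : length ω₁ ≡ G
  length-ω₁ = trans (length-tuples atoms K) (cong (_^ K) length-atoms)

  length-ω₂ : length ω₂ ≡ X
  length-ω₂ = trans (length-tuples ω₁ B) (cong (_^ B) length-ω₁)

  length-ω₃ : length ω₃ ≡ X ^ suc M
  length-ω₃ = trans (length-tuples ω₂ (suc M)) (cong (_^ suc M) length-ω₂)

  module Counts (y : Fin M → Bool) where
    S R acc : ℕ
    S = cnt y (allFin M)
    R = (M₀ ∸ S ^ w) ^ K
    acc = (G ∸ R) ^ B

    cnt-atoms : cnt (acceptsAtom y) atoms ≡ S ^ w
    cnt-atoms = begin
      cnt (acceptsAtom y) atoms                  ≡⟨ cnt-++ (acceptsAtom y) (map just (tuples w (allFin M))) _ ⟩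
      cnt (acceptsAtom y) (map just (tuples w (allFin M))) + cnt (acceptsAtom y) (replicate (M ^ w) nothing)
        ≡⟨ cong₂ _+_ (trans (cnt-map (acceptsAtom y) just (tuples w (allFin M))) (cnt-allV y (allFin M) w)) (cnt-replicate (acceptsAtom y) (M ^ w) nothing) ⟩
      S ^ w + 0                                  ≡⟨ +-identityʳ (S ^ w) ⟩
      S ^ w                                      ∎
      where open ≡-Reasoning

    R≤G : R ≤ G
    R≤G = ^-monoˡ-≤ K (m∸n≤m M₀ (S ^ w))

    cnt-ω₁ : cnt (anyV (acceptsAtom y)) ω₁ ≡ G ∸ R
    cnt-ω₁ = begin
      cnt p ω₁                                         ≡⟨ m+n∸n≡m (cnt p ω₁) (cnt (not ∘ p) ω₁) ⟨
      cnt p ω₁ + cnt (not ∘ p) ω₁ ∸ cnt (not ∘ p) ω₁   ≡⟨ cong₂ _∸_ (trans (cnt+cnt-not p ω₁) length-ω₁) (cnt-not-anyV (acceptsAtom y) atoms K) ⟩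
      G ∸ (length atoms ∸ cnt (acceptsAtom y) atoms) ^ K ≡⟨ cong₂ (λ u v → G ∸ (u ∸ v) ^ K) length-atoms cnt-atoms ⟩
      G ∸ R                                            ∎
      where
      open ≡-Reasoning
      p : Vec (Atom M w) K → Bool
      p = anyV (acceptsAtom y)

    cnt-ω₂ : cnt (allV (anyV (acceptsAtom y))) ω₂ ≡ acc
    cnt-ω₂ = trans (cnt-allV _ ω₁ B) (cong (_^ B) cnt-ω₁)

    acc≤X : acc ≤ X
    acc≤X = ^-monoˡ-≤ B (m∸n≤m G R)

    rejecting : cnt (not ∘ accepts y) ω₃ ≡ (X ∸ acc) ^ suc M
    rejecting = trans (cnt-not-anyV _ ω₂ (suc M)) (cong₂ (λ u v → (u ∸ v) ^ suc M) length-ω₂ cnt-ω₂)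

    accepting : cnt (accepts y) ω₃ ≡ X ^ suc M ∸ (X ∸ acc) ^ suc M
    accepting = begin
      cnt (accepts y) ω₃                               ≡⟨ m+n∸n≡m _ (cnt (not ∘ accepts y) ω₃) ⟨
      cnt (accepts y) ω₃ + cnt (not ∘ accepts y) ω₃ ∸ cnt (not ∘ accepts y) ω₃
        ≡⟨ cong₂ _∸_ (trans (cnt+cnt-not (accepts y) ω₃) length-ω₃) rejecting ⟩
      X ^ suc M ∸ (X ∸ acc) ^ suc M                    ∎
      where open ≡-Reasoning

  -- Tells whether an answer is wrong; strictly between the two thresholds either answer is
  -- admissible, so no seed is bad there.
  verdict : {P Q : Set} → Dec P → Dec Q → Bool → Bool
  verdict (yes _) _       b = not b
  verdict (no _)  (yes _) b = b
  verdict (no _)  (no _)  b = false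

  high? : ∀ y → Dec (c ≤ cnt y (allFin M))
  high? y = c ≤? cnt y (allFin M)

  low? : ∀ y → Dec (cnt y (allFin M) + g ≤ c)
  low? y = cnt y (allFin M) + g ≤? c

  bad : Vec Bool M → Seed M w K B (suc M) → Bool
  bad v s = verdict (high? (Vec.lookup v)) (low? (Vec.lookup v)) (accepts (Vec.lookup v) s)

  few-bad : ∀ v → cnt (bad v) ω₃ * 2 ^ M < X ^ suc M
  few-bad v = go (high? y) (low? y)
    where
    y : Fin M → Bool
    y = Vec.lookup v
    open Counts y
    go : (h : Dec (c ≤ cnt y (allFin M))) (l : Dec (cnt y (allFin M) + g ≤ c)) → cnt (λ s → verdict h l (accepts y s)) ω₃ * 2 ^ M < X ^ suc M
    go (yes c≤S) _ = subst (λ z → z * 2 ^ M < X ^ suc M) (sym rejecting)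
      (high-bad acc (high-accepts R (subst (λ z → R ≤ (M₀ ∸ z) ^ K) (sym a+δ) (^-monoˡ-≤ K (∸-monoʳ-≤ M₀ (^-monoˡ-≤ w c≤S)))) R≤G))
    go (no _) (yes S+g≤c) = subst (λ z → z * 2 ^ M < X ^ suc M) (sym accepting)
      (low-bad acc acc≤X (low-accepts R (^-monoˡ-≤ K (∸-monoʳ-≤ M₀ (^-monoˡ-≤ w (m+n≤o⇒m≤o∸n S S+g≤c)))) R≤G))
    go (no _) (no _) = subst (λ z → z * 2 ^ M < X ^ suc M) (sym (cnt-false ω₃)) (^-positive X (suc M) (^-positive G B 0<G))

  assignments : List (Vec Bool M)
  assignments = tuples M (true ∷ false ∷ [])

  length-assignments : length assignments ≡ 2 ^ M
  length-assignments = length-tuples (true ∷ false ∷ []) M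

  ∈-bools : ∀ b → b ∈ true ∷ false ∷ []
  ∈-bools true  = here refl
  ∈-bools false = there (here refl)

  found : ∃ λ s → ∀ {v} → v ∈ assignments → bad v s ≡ false
  found = union-bound bad assignments ω₃
    (λ v → subst₂ (λ u z → cnt (bad v) ω₃ * u < z) (sym length-assignments) (sym length-ω₃) (few-bad v))
    (subst (0 <_) (sym length-assignments) (m^n>0 2 M))

  seed : Seed M w K B (suc M)
  seed = proj₁ found

  assignment : (Fin M → Bool) → Vec Bool M
  assignment = Vec.tabulate

  table : ∀ y i → Vec.lookup (assignment y) i ≡ y i
  table = lookup∘tabulate

  complete′ : ∀ v → c ≤ cnt (Vec.lookup v) (allFin M) → accepts (Vec.lookup v) seed ≡ true
  complete′ v c≤S = go (high? y) (low? y) (proj₂ found (∈-tuples ∈-bools v))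
    where
    y : Fin M → Bool
    y = Vec.lookup v
    go : (h : Dec (c ≤ cnt y (allFin M))) (l : Dec (cnt y (allFin M) + g ≤ c)) → verdict h l (accepts y seed) ≡ false → accepts y seed ≡ true
    go (yes _)  _ e = not-injective e
    go (no c≰S) _ _ = ⊥-elim (c≰S c≤S)

  sound′ : ∀ v → cnt (Vec.lookup v) (allFin M) + g ≤ c → accepts (Vec.lookup v) seed ≡ false
  sound′ v S+g≤c = go (high? y) (low? y) (proj₂ found (∈-tuples ∈-bools v))
    where
    y : Fin M → Bool
    y = Vec.lookup v
    go : (h : Dec (c ≤ cnt y (allFin M))) (l : Dec (cnt y (allFin M) + g ≤ c)) → verdict h l (accepts y seed) ≡ false → accepts y seed ≡ false
    go (yes c≤S) _ _ = ⊥-elim (m+1+n≰m _ {pred g} (≤-trans (≤-reflexive (cong (cnt y (allFin M) +_) (suc-pred g {{>-nonZero 0<g}}))) (≤-trans S+g≤c c≤S)))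
    go (no _) (yes _) e = e
    go (no _) (no ¬p) _ = ⊥-elim (¬p S+g≤c)

-- Abstract because unfolding the construction makes type checking intractable.
abstract
  separator : ∀ M w t g c ζ → 0 < w → 0 < g → g ≤ c → c ≤ M → M ≤ w * g * t → 4 * (2 * M + 1) ≤ 2 ^ ζ →
    ∃ λ K → ∃ λ B → K ≤ suc (2 * M ^ w) * ζ × B ≤ 2 ^ suc (8 * ζ * t) * (2 * M + 1) × Separator M w g c K B
  separator = separator-exists

-- Residues of counts through binomial coefficients

binom : ℕ → ℕ → ℕ
binom n       zero    = 1
binom zero    (suc k) = 0
binom (suc n) (suc k) = binom n k + binom n (suc k)

combos : ∀ k → List A → List (Vec A k)
combos zero    xs       = [] ∷ []
combos (suc k) []       = []
combos (suc k) (x ∷ xs) = map (x ∷_) (combos k xs) ++ combos (suc k) xs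

cnt-combos : (p : A → Bool) → ∀ k xs → cnt (allV p) (combos k xs) ≡ binom (cnt p xs) k
cnt-combos p zero    xs = refl
cnt-combos p (suc k) [] = refl
cnt-combos p (suc k) (x ∷ xs)
  rewrite cnt-++ (allV p) (map (x ∷_) (combos k xs)) (combos (suc k) xs)
        | cnt-map (allV p) (x ∷_) (combos k xs)
        | cnt-combos p (suc k) xs
  with p x
... | true  = cong (_+ binom (cnt p xs) (suc k)) (cnt-combos p k xs)
... | false = cong (_+ binom (cnt p xs) (suc k)) (cnt-false (combos k xs))

length-combos : ∀ k (xs : List A) → length (combos k xs) ≤ suc (length xs) ^ k
length-combos zero    xs       = ≤-refl
length-combos (suc k) []       = z≤n
length-combos (suc k) (x ∷ xs) = begin
  length (map (x ∷_) (combos k xs) ++ combos (suc k) xs)           ≡⟨ length-++ (map (x ∷_) (combos k xs)) ⟩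
  length (map (x ∷_) (combos k xs)) + length (combos (suc k) xs)   ≡⟨ cong (_+ length (combos (suc k) xs)) (length-map (x ∷_) (combos k xs)) ⟩
  length (combos k xs) + length (combos (suc k) xs)                ≤⟨ +-mono-≤ (length-combos k xs) (length-combos (suc k) xs) ⟩
  suc (suc (length xs)) * suc (length xs) ^ k                      ≤⟨ *-monoʳ-≤ (suc (suc (length xs))) (^-monoˡ-≤ k (n≤1+n _)) ⟩
  suc (suc (length xs)) ^ suc k                                    ∎
  where open ≤-Reasoning

binom-1 : ∀ n → binom n 1 ≡ n
binom-1 zero    = refl
binom-1 (suc n) = cong suc (binom-1 n)

binom-absorption : ∀ n k → suc k * binom (suc n) (suc k) ≡ suc n * binom n k
binom-absorption n zero = trans (+-identityʳ _) (trans (cong suc (binom-1 n)) (sym (*-identityʳ (suc n))))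
binom-absorption zero (suc k) = *-zeroʳ (suc (suc k))
binom-absorption (suc n) (suc k) = begin
  suc (suc k) * (b₁ + b₂)                      ≡⟨ l₁ k b₁ b₂ ⟩
  suc k * b₁ + b₁ + suc (suc k) * b₂           ≡⟨ cong₂ (λ u v → u + b₁ + v) (binom-absorption n k) (binom-absorption n (suc k)) ⟩
  suc n * binom n k + b₁ + suc n * binom n (suc k) ≡⟨ l₂ n (binom n k) (binom n (suc k)) ⟩
  suc (suc n) * b₁                             ∎
  where
  open ≡-Reasoning
  b₁ b₂ : ℕ
  b₁ = binom (suc n) (suc k)
  b₂ = binom (suc n) (suc (suc k))
  l₁ : ∀ k x y → suc (suc k) * (x + y) ≡ suc k * x + x + suc (suc k) * y
  l₁ = solve-∀
  l₂ : ∀ n x y → suc n * x + (x + y) + suc n * y ≡ suc (suc n) * (x + y)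
  l₂ = solve-∀

binom-> : ∀ {n k} → n < k → binom n k ≡ 0
binom-> {zero}  {suc k} _         = refl
binom-> {suc n} {suc k} (s≤s n<k) = cong₂ _+_ (binom-> n<k) (binom-> (m<n⇒m<1+n n<k))

binom-self : ∀ n → binom n n ≡ 1
binom-self zero    = refl
binom-self (suc n) = cong₂ _+_ (binom-self n) (binom-> (n<1+n n))

prime-power-cancel : ∀ {p} → Prime p → ∀ e i b → ¬ p ∣ b → p ^ e ∣ i * b → p ^ e ∣ i
prime-power-cancel pr zero    i b ¬p∣b h = 1∣ i
prime-power-cancel {p} pr (suc e) i b ¬p∣b h
  with euclidsLemma i b pr (∣-trans (m∣m*n (p ^ e)) h)
... | inj₂ p∣b = ⊥-elim (¬p∣b p∣b)
... | inj₁ (divides i′ refl) = subst (p * p ^ e ∣_) (*-comm p i′)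
  (*-monoʳ-∣ p (prime-power-cancel pr e i′ b ¬p∣b
    (*-cancelˡ-∣ p {{prime⇒nonZero pr}} (subst (p * p ^ e ∣_) (l i′ p b) h))))
  where
  l : ∀ i p b → i * p * b ≡ p * (i * b)
  l = solve-∀

-- For Q = p^e, absorption reads i·C(Q, i) = Q·C(Q - 1, i - 1). If p did not divide C(Q, i), all of
-- Q would divide i, which is smaller.
prime∣binom : ∀ {p} → Prime p → ∀ e i → 0 < i → i < p ^ e → p ∣ binom (p ^ e) i
prime∣binom {p} pr e (suc k) 0<i i<Q = go (p ^ e) refl
  where
  go : ∀ Q → p ^ e ≡ Q → p ∣ binom Q (suc k)
  go zero    eq = p ∣0
  go (suc n) eq with p ∣? binom (suc n) (suc k)
  ... | yes d = d
  ... | no ¬d = ⊥-elim (<⇒≱ i<Q (∣⇒≤ (prime-power-cancel pr e (suc k) (binom (suc n) (suc k)) ¬d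
                  (subst₂ _∣_ (sym eq) (sym (binom-absorption n k)) (m∣m*n (binom n k))))))

0%n≡0 : ∀ n .{{_ : NonZero n}} → 0 % n ≡ 0
0%n≡0 (suc n) = refl

module Periodicity {p} (pr : Prime p) (e : ℕ) where

  private instance
    _ = prime⇒nonZero pr

  Q : ℕ
  Q = p ^ e

  infix 4 _≈_
  _≈_ : ℕ → ℕ → Set
  a ≈ b = a % p ≡ b % p

  +-cong-≈ : ∀ {a b c d} → a ≈ b → c ≈ d → a + c ≈ b + d
  +-cong-≈ {a} {b} {c} {d} h h′ = trans (%-distribˡ-+ a c p) (trans (cong₂ (λ u v → (u + v) % p) h h′) (sym (%-distribˡ-+ b d p)))

  -- The coefficients below degree Q of (1 + X)^(n+Q) ≡ (1 + X)^n·(1 + X^Q) modulo p. Pascal's rule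
  -- carries the case n = 0, which is `prime∣binom`, to all n.
  binom-period : ∀ n k → k < Q → binom (n + Q) k ≈ binom n k
  binom-period n       zero    k<Q = refl
  binom-period zero    (suc k) k<Q = trans (n∣m⇒m%n≡0 _ p (prime∣binom pr e (suc k) (s≤s z≤n) k<Q)) (sym (0%n≡0 p))
  binom-period (suc n) (suc k) k<Q = +-cong-≈ (binom-period n k (<-trans (n<1+n k) k<Q)) (binom-period n (suc k) k<Q)

  binom-periods : ∀ a n k → k < Q → binom (n + a * Q) k ≈ binom n k
  binom-periods zero    n k k<Q = cong (λ z → binom z k % p) (+-identityʳ n)
  binom-periods (suc a) n k k<Q = trans (cong (λ z → binom z k % p) (l n Q (a * Q))) (trans (binom-period (n + a * Q) k k<Q) (binom-periods a n k k<Q))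
    where
    l : ∀ n q r → n + (q + r) ≡ n + r + q
    l = solve-∀

  -- Pascal's rule computes the coefficients of a + 1 in degrees below Q from those of a in the same
  -- degrees, so agreement survives each increment.
  binom-shift : ∀ {u c} → (∀ k → k < Q → binom u k ≈ binom c k) → ∀ s k → k < Q → binom (s + u) k ≈ binom (s + c) k
  binom-shift h zero    k       k<Q = h k k<Q
  binom-shift h (suc s) zero    k<Q = refl
  binom-shift h (suc s) (suc k) k<Q = +-cong-≈ (binom-shift h s k (<-trans (n<1+n k) k<Q)) (binom-shift h s (suc k) k<Q)

  private
    0<Q : 0 < Q
    0<Q = ^-positive p e (>-nonZero⁻¹ p)

    instance
      Q≢0 : NonZero Q
      Q≢0 = >-nonZero 0<Q

  -- A nonzero remainder b of v would give C(v, b) ≡ C(b, b) = 1 by periodicity.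
  vanishing⇒∣ : ∀ v → (∀ k → 0 < k → k < Q → binom v k ≈ 0) → Q ∣ v
  vanishing⇒∣ v h = go (v % Q) refl
    where
    go : ∀ b → v % Q ≡ b → Q ∣ v
    go zero    eq = m%n≡0⇒n∣m v Q eq
    go b@(suc _) eq = ⊥-elim (0≢1+n (trans (sym (0%n≡0 p)) (trans (sym (h b (s≤s z≤n) b<Q)) (trans b≈1 (m<n⇒m%n≡m (nonTrivial⇒n>1 p {{prime⇒nonTrivial pr}}))))))
      where
      b<Q : b < Q
      b<Q = subst (_< Q) eq (m%n<n v Q)
      b≈1 : binom v b ≈ 1
      b≈1 = trans (cong (λ z → binom z b % p) (trans (m≡m%n+[m/n]*n v Q) (cong (_+ v / Q * Q) eq)))
        (trans (binom-periods (v / Q) b b b<Q) (cong (_% p) (binom-self b)))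

  -- Adding the same s to u and c, chosen so that Q ∣ s + c, reduces the claim to the case c ≡ 0.
  binoms-determine : ∀ u c → (∀ k → k < Q → binom u k ≈ binom c k) → ∃ λ s → Q ∣ s + u × Q ∣ s + c
  binoms-determine u c h = s , vanishing⇒∣ (s + u) (λ k 0<k k<Q → trans (binom-shift {u} {c} h s k k<Q) (vanish k 0<k k<Q))
                             , divides c s+c
    where
    s : ℕ
    s = pred Q * c
    s+c : s + c ≡ c * Q
    s+c = trans (+-comm s c) (trans (cong (_* c) (suc-pred Q)) (*-comm Q c))
    vanish : ∀ k → 0 < k → k < Q → binom (s + c) k ≈ 0
    vanish (suc k) _ k<Q = trans (cong (λ z → binom z (suc k) % p) s+c) (binom-periods c 0 (suc k) k<Q)

∣-∸ : ∀ {d} a b → d ∣ a → d ∣ b → d ∣ a ∸ b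
∣-∸ {d} a b d∣a d∣b with ≤-total b a
... | inj₁ b≤a = ∣m+n∣m⇒∣n {m = b} (subst (d ∣_) (sym (m+[n∸m]≡n b≤a)) d∣a) d∣b
... | inj₂ a≤b = subst (d ∣_) (sym (m≤n⇒m∸n≡0 a≤b)) (d ∣0)

-- A prime q, a degree k and a shift s. A MOD gate detects only residue 0, so the expected residue
-- of C(v, k) is moved to 0 by adding s.
Test : Set
Test = ℕ × ℕ × ℕ

Pass : ℕ → Test → Set
Pass v (q , k , s) = q ∣ binom v k + s

passes⇒∣ : ∀ {q} (pr : Prime q) e u c (s : ℕ → ℕ) →
  (∀ k → k < q ^ e → q ∣ binom u k + s k) → (∀ k → k < q ^ e → q ∣ binom c k + s k) →
  q ^ e ∣ u ∸ c × q ^ e ∣ c ∸ u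
passes⇒∣ {q} pr e u c s hu hc with binoms-determine u c eq
  where
  open Periodicity pr e
  instance
    _ = prime⇒nonZero pr
  cancel : ∀ a b s → q ∣ a + s → q ∣ b + s → a ≈ b
  cancel a b s qa qb = trans (sym (%-remove-+ʳ a qb)) (trans (cong (_% q) (l a b s)) (%-remove-+ʳ b qa))
    where
    l : ∀ a b s → a + (b + s) ≡ b + (a + s)
    l = solve-∀
  eq : ∀ k → k < q ^ e → binom u k ≈ binom c k
  eq k k<Q = cancel (binom u k) (binom c k) (s k) (hu k k<Q) (hc k k<Q)
... | z , du , dc = subst (q ^ e ∣_) ([m+n]∸[m+o]≡n∸o z u c) (∣-∸ _ _ du dc)
                  , subst (q ^ e ∣_) ([m+n]∸[m+o]≡n∸o z c u) (∣-∸ _ _ dc du)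

shift : ∀ q .{{_ : NonZero q}} a → ∃ λ s → s ≤ q × q ∣ a + s
shift q a = q ∸ a % q , m∸n≤m q (a % q) , divides (suc (a / q)) (begin
  a + (q ∸ a % q)                    ≡⟨ cong (_+ (q ∸ a % q)) (m≡m%n+[m/n]*n a q) ⟩
  a % q + a / q * q + (q ∸ a % q)    ≡⟨ l (a % q) (a / q * q) (q ∸ a % q) ⟩
  a % q + (q ∸ a % q) + a / q * q    ≡⟨ cong (_+ a / q * q) (m+[n∸m]≡n (<⇒≤ (m%n<n a q))) ⟩
  q + a / q * q                      ∎)
  where
  open ≡-Reasoning
  l : ∀ x y z → x + y + z ≡ x + z + y
  l = solve-∀

-- The lower bound lets the product of the r prime powers reach t^r; the upper bound keeps the
-- degrees of the monomials at O(t).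
exponent : ∀ q → 1 < q → ∀ t → 0 < t → ∃ λ e → t ≤ q ^ e × q ^ e ≤ q * t
exponent q 1<q (suc zero)    _ = 0 , ≤-refl , ≤-trans (<⇒≤ 1<q) (≤-reflexive (sym (*-identityʳ q)))
exponent q 1<q (suc t@(suc _)) _ with exponent q 1<q t (s≤s z≤n)
... | e , lo , hi with m≤n⇒m<n∨m≡n lo
...   | inj₁ t<Q = e , t<Q , ≤-trans hi (*-monoʳ-≤ q (n≤1+n t))
...   | inj₂ t≡Q = suc e , below , *-monoʳ-≤ q (≤-trans (≤-reflexive (sym t≡Q)) (n≤1+n t))
  where
  below : suc t ≤ q * q ^ e
  below = begin
    suc t       ≤⟨ s≤s (m≤n+m t (pred t)) ⟩
    t + t       ≡⟨ 2*n≡n+n t ⟨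
    2 * t       ≤⟨ *-monoˡ-≤ t 1<q ⟩
    q * t       ≡⟨ cong (q *_) t≡Q ⟩
    q * q ^ e   ∎
    where open ≤-Reasoning

prime∣^⇒∣ : ∀ {p} → Prime p → ∀ q e → p ∣ q ^ e → p ∣ q
prime∣^⇒∣ {p} pr q zero    h = ⊥-elim (<⇒≱ (nonTrivial⇒n>1 p {{prime⇒nonTrivial pr}}) (∣⇒≤ h))
prime∣^⇒∣ pr q (suc e) h with euclidsLemma q (q ^ e) pr h
... | inj₁ d = d
... | inj₂ d = prime∣^⇒∣ pr q e d

prime∣prime⇒≡ : ∀ {p q} → Prime p → Prime q → p ∣ q → p ≡ q
prime∣prime⇒≡ {p} pp pq d with prime⇒irreducible pq d
... | inj₁ p≡1 = ⊥-elim (<⇒≢ (nonTrivial⇒n>1 p {{prime⇒nonTrivial pp}}) (sym p≡1))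
... | inj₂ p≡q = p≡q

-- `modulus-primes` is the invariant that makes the power of the next prime coprime to the modulus
-- built so far. Congruence appears as divisibility of both truncated differences.
record ResidueTests (m t c : ℕ) (qs : List ℕ) : Set where
  field
    tests   : List Test
    length≤ : length tests ≤ length qs * (m * t)
    valid   : All (λ (q , k , s) → Prime q × q ∈ qs × k ≤ m * t × s ≤ q × q ∣ binom c k + s) tests
    modulus : ℕ
    modulus≥ : t ^ length qs ≤ modulus
    modulus-primes : ∀ {p} → Prime p → p ∣ modulus → p ∈ qs
    modulus∣ : ∀ v → All (Pass v) tests → modulus ∣ v ∸ c × modulus ∣ c ∸ v

residueTests : ∀ m t c qs → 0 < t → Unique qs → All Prime qs → All (_≤ m) qs → ResidueTests m t c qs
residueTests m t c [] 0<t _ _ _ = record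
  { tests = [] ; length≤ = z≤n ; valid = [] ; modulus = 1 ; modulus≥ = ≤-refl
  ; modulus-primes = λ {p} pr d → ⊥-elim (<⇒≱ (nonTrivial⇒n>1 p {{prime⇒nonTrivial pr}}) (∣⇒≤ d))
  ; modulus∣ = λ v _ → 1∣ _ , 1∣ _ }
residueTests m t c (q ∷ qs) 0<t (q∉ ∷ uniq) (pr ∷ prs) (q≤m ∷ qs≤m) = record
  { tests = new ++ R.tests
  ; length≤ = ≤-trans (≤-reflexive (length-++ new)) (+-mono-≤ (≤-trans (≤-reflexive (trans (length-map mk (upTo Q)) (length-upTo Q))) Q≤mt) R.length≤)
  ; valid = Allₚ.++⁺ (Allₚ.map⁺ (All.tabulate λ {k} k∈ → pr , here refl , <⇒≤ (<-≤-trans (∈-upTo⁻ k∈) Q≤mt) , proj₁ (proj₂ (sh k)) , proj₂ (proj₂ (sh k))))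
                     (All.map (λ (a , b , r) → a , there b , r) R.valid)
  ; modulus = Q * R.modulus
  ; modulus≥ = *-mono-≤ t≤Q R.modulus≥
  ; modulus-primes = primes
  ; modulus∣ = λ v ps → let here∣ = passes⇒∣ pr e v c (λ k → proj₁ (sh k)) (newPass v (Allₚ.++⁻ˡ new ps)) (λ k _ → proj₂ (proj₂ (sh k)))
                            rest∣ = R.modulus∣ v (Allₚ.++⁻ʳ new ps)
                        in combine (proj₁ here∣) (proj₁ rest∣) , combine (proj₂ here∣) (proj₂ rest∣)
  }
  where
  module R = ResidueTests (residueTests m t c qs 0<t uniq prs qs≤m)
  instance
    _ = prime⇒nonZero pr
  ex : ∃ λ e → t ≤ q ^ e × q ^ e ≤ q * t
  ex = exponent q (nonTrivial⇒n>1 q {{prime⇒nonTrivial pr}}) t 0<t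
  e Q : ℕ
  e = proj₁ ex
  Q = q ^ e
  t≤Q : t ≤ Q
  t≤Q = proj₁ (proj₂ ex)
  Q≤mt : Q ≤ m * t
  Q≤mt = ≤-trans (proj₂ (proj₂ ex)) (*-monoˡ-≤ t q≤m)
  sh : ∀ k → ∃ λ s → s ≤ q × q ∣ binom c k + s
  sh k = shift q (binom c k)
  mk : ℕ → Test
  mk k = q , k , proj₁ (sh k)
  new : List Test
  new = map mk (upTo Q)
  newPass : ∀ v → All (Pass v) new → ∀ k → k < Q → q ∣ binom v k + proj₁ (sh k)
  newPass v ps k k<Q = All.lookup (Allₚ.map⁻ ps) (∈-upTo⁺ k<Q)
  primes : ∀ {p} → Prime p → p ∣ Q * R.modulus → p ∈ q ∷ qs
  primes pp d with euclidsLemma Q R.modulus pp d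
  ... | inj₁ d′ = here (prime∣prime⇒≡ pp pr (prime∣^⇒∣ pp q e d′))
  ... | inj₂ d′ = there (R.modulus-primes pp d′)
  combine : ∀ {D} → Q ∣ D → R.modulus ∣ D → Q * R.modulus ∣ D
  combine Q∣D (divides x refl) = *-monoˡ-∣ R.modulus
    (prime-power-cancel pr e x R.modulus (λ d → All.lookup q∉ (R.modulus-primes pr d) refl) Q∣D)

tests-separate : ∀ {m t c qs} (R : ResidueTests m t c qs) → ∀ v → All (Pass v) (ResidueTests.tests R) →
  v ∸ c < t ^ length qs → c ∸ v < t ^ length qs → v ≡ c
tests-separate {t = t} {c} {qs} R v ps hv hc = ≤-antisym (m∸n≡0⇒m≤n (small (proj₁ (modulus∣ v ps)) hv)) (m∸n≡0⇒m≤n (small (proj₂ (modulus∣ v ps)) hc))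
  where
  open ResidueTests R
  small : ∀ {D} → modulus ∣ D → D < t ^ length qs → D ≡ 0
  small {zero}  _ _ = refl
  small {suc D} d h = ⊥-elim (<⇒≱ (<-≤-trans h modulus≥) (∣⇒≤ d))

-- Residue classes exclude each other, so the negation of a MOD test is an OR of MOD tests.
not-∣? : ∀ q .{{_ : NonZero q}} a → not (does (q ∣? a)) ≡ any (λ j → does (q ∣? a + j)) (map suc (upTo (pred q)))
not-∣? q a with q ∣? a
... | yes q∣a = sym (none (map suc (upTo (pred q))) λ {j} j∈ → not-divides j∈)
  where
  none : ∀ js → (∀ {j} → j ∈ js → ¬ q ∣ a + j) → any (λ j → does (q ∣? a + j)) js ≡ false
  none []       h = refl
  none (j ∷ js) h with q ∣? a + j
  ... | yes d = ⊥-elim (h (here refl) d)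
  ... | no _  = none js (h ∘ there)
  not-divides : ∀ {j} → j ∈ map suc (upTo (pred q)) → ¬ q ∣ a + j
  not-divides j∈ d with ∈-map⁻ suc j∈
  ... | i , i∈ , refl = <⇒≱ (subst (suc (suc i) ≤_) (suc-pred q) (s≤s (∈-upTo⁻ i∈))) (∣⇒≤ (∣m+n∣m⇒∣n d q∣a))
... | no ¬q∣a = sym (some (∈-map⁺ suc (∈-upTo⁺ i<)) (subst (λ z → q ∣ a + z) (sym j≡) (proj₂ (proj₂ (shift q a)))))
  where
  some : ∀ {js j} → j ∈ js → q ∣ a + j → any (λ j → does (q ∣? a + j)) js ≡ true
  some {j ∷ js} (here refl) d with q ∣? a + j
  ... | yes _ = refl
  ... | no ¬d = ⊥-elim (¬d d)
  some {j ∷ js} (there i) d with q ∣? a + j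
  ... | yes _ = refl
  ... | no _  = some i d
  0<a%q : 0 < a % q
  0<a%q = n≢0⇒n>0 (λ e → ¬q∣a (m%n≡0⇒n∣m a q e))
  j : ℕ
  j = q ∸ a % q
  0<j : 0 < j
  0<j = m<n⇒0<n∸m (m%n<n a q)
  j≡ : suc (pred j) ≡ j
  j≡ = suc-pred j {{>-nonZero 0<j}}
  i< : pred j < pred q
  i< = s<s⁻¹ (subst₂ _<_ (sym j≡) (sym (suc-pred q)) (∸-monoʳ-< {q} 0<a%q (<⇒≤ (m%n<n a q))))

-- Layered formulas

all-++ : (p : A → Bool) (xs ys : List A) → all p (xs ++ ys) ≡ all p xs ∧ all p ys
all-++ p []       ys = refl
all-++ p (x ∷ xs) ys = trans (cong (p x ∧_) (all-++ p xs ys)) (sym (∧-assoc (p x) _ _))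

any-++ : (p : A → Bool) (xs ys : List A) → any p (xs ++ ys) ≡ any p xs ∨ any p ys
any-++ p []       ys = refl
any-++ p (x ∷ xs) ys = trans (cong (p x ∨_) (any-++ p xs ys)) (sym (∨-assoc (p x) _ _))

deMorgan₁ : ∀ a b → not (a ∧ b) ≡ not a ∨ not b
deMorgan₁ true  b = refl
deMorgan₁ false b = refl

deMorgan₂ : ∀ a b → not (a ∨ b) ≡ not a ∧ not b
deMorgan₂ true  b = refl
deMorgan₂ false b = refl

length-cartesianProductWith : {B C : Set} (f : A → B → C) (xs : List A) (ys : List B) →
  length (cartesianProductWith f xs ys) ≡ length xs * length ys
length-cartesianProductWith f []       ys = refl
length-cartesianProductWith f (x ∷ xs) ys =
  trans (length-++ (map (f x) ys)) (cong₂ _+_ (length-map (f x) ys) (length-cartesianProductWith f xs ys))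

does-cong : {P Q : Set} (p? : Dec P) (q? : Dec Q) → (P → Q) → (Q → P) → does p? ≡ does q?
does-cong (yes p) (yes q) f g = refl
does-cong (yes p) (no ¬q) f g = ⊥-elim (¬q (f p))
does-cong (no ¬p) (yes q) f g = ⊥-elim (¬p (g q))
does-cong (no ¬p) (no ¬q) f g = refl

module Formulas (n m L : ℕ) where

  Input : Set
  Input = Fin n → Bool

  -- Trees without sharing suffice: at constant depth, fan-in `L` gives only L^O(1) gates. `lift` is
  -- an empty level that makes all arguments of a gate equally deep.
  data Formula : ℕ → Set where
    var         : Fin n → Formula 0
    lift negate : ∀ {d} → Formula d → Formula (suc d)
    and or mod  : ∀ {d} (φs : List (Formula d)) → length φs ≤ L → Formula (suc d)

  eval : ∀ {d} → Input → Formula d → Bool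
  eval {zero}  x (var i)    = x i
  eval {suc d} x (lift φ)   = eval {d} x φ
  eval {suc d} x (negate φ) = not (eval {d} x φ)
  eval {suc d} x (and φs _) = all (eval {d} x) φs
  eval {suc d} x (or φs _)  = any (eval {d} x) φs
  eval {suc d} x (mod φs _) = does (m ∣? cnt (eval {d} x) φs)

  record Lit (d : ℕ) (p : Input → Bool) : Set where
    field
      pos neg : Formula d
      pos✓    : ∀ x → eval x pos ≡ p x
      neg✓    : ∀ x → eval x neg ≡ not (p x)

  -- Negating a MOD gate would cost depth, so a conjunction carries a disjunction for its negation.
  record Conj (d w : ℕ) (p : Input → Bool) : Set where
    field
      cs ds : List (Formula d)
      cs≤   : length cs ≤ w
      ds≤   : length ds ≤ w
      cs✓   : ∀ x → all (eval x) cs ≡ p x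
      ds✓   : ∀ x → any (eval x) ds ≡ not (p x)

  private variable
    d e w w₁ w₂ ℓ ℓ₁ ℓ₂ : ℕ
    p q : Input → Bool

  lit-cong : (∀ x → p x ≡ q x) → Lit d p → Lit d q
  lit-cong h l = record
    { pos = pos ; neg = neg ; pos✓ = λ x → trans (pos✓ x) (h x) ; neg✓ = λ x → trans (neg✓ x) (cong not (h x)) }
    where open Lit l

  lit-not : Lit d p → Lit d (not ∘ p)
  lit-not {p = p} l = record { pos = neg ; neg = pos ; pos✓ = neg✓ ; neg✓ = λ x → trans (pos✓ x) (sym (not-involutive (p x))) }
    where open Lit l

  lit-lift : (φ : Formula d) → Lit (suc d) (λ x → eval x φ)
  lit-lift φ = record { pos = lift φ ; neg = negate φ ; pos✓ = λ _ → refl ; neg✓ = λ _ → refl }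

  conj-cong : (∀ x → p x ≡ q x) → Conj d w p → Conj d w q
  conj-cong h c = record
    { cs = cs ; ds = ds ; cs≤ = cs≤ ; ds≤ = ds≤ ; cs✓ = λ x → trans (cs✓ x) (h x) ; ds✓ = λ x → trans (ds✓ x) (cong not (h x)) }
    where open Conj c

  conj-weaken : w₁ ≤ w₂ → Conj d w₁ p → Conj d w₂ p
  conj-weaken h c = record { cs = cs ; ds = ds ; cs≤ = ≤-trans cs≤ h ; ds≤ = ≤-trans ds≤ h ; cs✓ = cs✓ ; ds✓ = ds✓ }
    where open Conj c

  lit→conj : Lit d p → Conj d 1 p
  lit→conj l = record
    { cs = pos ∷ [] ; ds = neg ∷ [] ; cs≤ = ≤-refl ; ds≤ = ≤-refl
    ; cs✓ = λ x → trans (∧-identityʳ _) (pos✓ x) ; ds✓ = λ x → trans (∨-identityʳ _) (neg✓ x) }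
    where open Lit l

  conj→lit : w ≤ L → Conj d w p → Lit (suc d) p
  conj→lit h c = record { pos = and cs (≤-trans cs≤ h) ; neg = or ds (≤-trans ds≤ h) ; pos✓ = cs✓ ; neg✓ = ds✓ }
    where open Conj c

  conj-true : Conj d 0 (const true)
  conj-true = record { cs = [] ; ds = [] ; cs≤ = z≤n ; ds≤ = z≤n ; cs✓ = λ _ → refl ; ds✓ = λ _ → refl }

  conj-∧ : Conj d w₁ p → Conj d w₂ q → Conj d (w₁ + w₂) (λ x → p x ∧ q x)
  conj-∧ {p = p} {q = q} a b = record
    { cs = A.cs ++ B.cs ; ds = A.ds ++ B.ds
    ; cs≤ = ≤-trans (≤-reflexive (length-++ A.cs)) (+-mono-≤ A.cs≤ B.cs≤)
    ; ds≤ = ≤-trans (≤-reflexive (length-++ A.ds)) (+-mono-≤ A.ds≤ B.ds≤)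
    ; cs✓ = λ x → trans (all-++ (eval x) A.cs B.cs) (cong₂ _∧_ (A.cs✓ x) (B.cs✓ x))
    ; ds✓ = λ x → trans (any-++ (eval x) A.ds B.ds) (trans (cong₂ _∨_ (A.ds✓ x) (B.ds✓ x)) (sym (deMorgan₁ (p x) (q x))))
    }
    where
    module A = Conj a
    module B = Conj b

  conj-all : (p : A → Input → Bool) (as : List A) → All (λ a → Conj d w (p a)) as →
    Conj d (length as * w) (λ x → all (λ a → p a x) as)
  conj-all p []       []       = conj-true
  conj-all p (a ∷ as) (c ∷ cs) = conj-∧ c (conj-all p as cs)

  -- An OR of ANDs kept as data rather than as gates, so that the ORs and ANDs coming from guesses,
  -- thresholds and residues can be multiplied out into the same two levels.
  record Choice (d ℓ w : ℕ) (p : Input → Bool) : Set where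
    field
      alts  : List (∃ (Conj d w))
      alts≤ : length alts ≤ ℓ
      alts✓ : ∀ x → any (λ a → proj₁ a x) alts ≡ p x

  choice-cong : (∀ x → p x ≡ q x) → Choice d ℓ w p → Choice d ℓ w q
  choice-cong h c = record { alts = alts ; alts≤ = alts≤ ; alts✓ = λ x → trans (alts✓ x) (h x) }
    where open Choice c

  choice-weaken : ℓ₁ ≤ ℓ₂ → w₁ ≤ w₂ → Choice d ℓ₁ w₁ p → Choice d ℓ₂ w₂ p
  choice-weaken {w₁ = w₁} {w₂ = w₂} {d = d} {p = p} hℓ hw c = record
    { alts = map wk alts ; alts≤ = ≤-trans (≤-reflexive (length-map wk alts)) (≤-trans alts≤ hℓ)
    ; alts✓ = λ x → trans (same x alts) (alts✓ x) }
    where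
    open Choice c
    wk : ∃ (Conj d w₁) → ∃ (Conj d w₂)
    wk (p , a) = p , conj-weaken hw a
    same : ∀ x as → any (λ a → proj₁ a x) (map wk as) ≡ any (λ a → proj₁ a x) as
    same x []       = refl
    same x (a ∷ as) = cong (proj₁ a x ∨_) (same x as)

  conj→choice : Conj d w p → Choice d 1 w p
  conj→choice {p = p} c = record { alts = (p , c) ∷ [] ; alts≤ = ≤-refl ; alts✓ = λ x → ∨-identityʳ (p x) }

  choice-false : Choice d ℓ w (const false)
  choice-false = record { alts = [] ; alts≤ = z≤n ; alts✓ = λ _ → refl }

  choice-∧ : Choice d ℓ₁ w₁ p → Choice d ℓ₂ w₂ q → Choice d (ℓ₁ * ℓ₂) (w₁ + w₂) (λ x → p x ∧ q x)
  choice-∧ {d = d} {w₁ = w₁} {w₂ = w₂} a b = record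
    { alts = cartesianProductWith both A.alts B.alts
    ; alts≤ = ≤-trans (≤-reflexive (length-cartesianProductWith both A.alts B.alts)) (*-mono-≤ A.alts≤ B.alts≤)
    ; alts✓ = λ x → trans (pairs A.alts x) (cong₂ _∧_ (A.alts✓ x) (B.alts✓ x))
    }
    where
    module A = Choice a
    module B = Choice b
    both : ∃ (Conj d w₁) → ∃ (Conj d w₂) → ∃ (Conj d (w₁ + w₂))
    both (p , c) (q , c′) = (λ x → p x ∧ q x) , conj-∧ c c′
    row : ∀ a bs x → any (λ a → proj₁ a x) (map (both a) bs) ≡ proj₁ a x ∧ any (λ a → proj₁ a x) bs
    row a []       x = sym (∧-zeroʳ (proj₁ a x))
    row a (b ∷ bs) x = trans (cong (proj₁ a x ∧ proj₁ b x ∨_) (row a bs x)) (sym (∧-distribˡ-∨ (proj₁ a x) (proj₁ b x) _))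
    pairs : ∀ as x → any (λ a → proj₁ a x) (cartesianProductWith both as B.alts) ≡ any (λ a → proj₁ a x) as ∧ any (λ a → proj₁ a x) B.alts
    pairs []       x = refl
    pairs (a ∷ as) x = trans (any-++ (λ a → proj₁ a x) (map (both a) B.alts) _)
      (trans (cong₂ _∨_ (row a B.alts x) (pairs as x)) (sym (∧-distribʳ-∨ (any (λ a → proj₁ a x) B.alts) (proj₁ a x) _)))

  choice-∨ : Choice d ℓ₁ w p → Choice d ℓ₂ w q → Choice d (ℓ₁ + ℓ₂) w (λ x → p x ∨ q x)
  choice-∨ a b = record
    { alts = A.alts ++ B.alts
    ; alts≤ = ≤-trans (≤-reflexive (length-++ A.alts)) (+-mono-≤ A.alts≤ B.alts≤)
    ; alts✓ = λ x → trans (any-++ (λ a → proj₁ a x) A.alts B.alts) (cong₂ _∨_ (A.alts✓ x) (B.alts✓ x))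
    }
    where
    module A = Choice a
    module B = Choice b

  choice-any : (p : A → Input → Bool) (as : List A) → (∀ a → Choice d ℓ w (p a)) →
    Choice d (length as * ℓ) w (λ x → any (λ a → p a x) as)
  choice-any p []       h = choice-false
  choice-any p (a ∷ as) h = choice-∨ (h a) (choice-any p as h)

  -- Only the inner ANDs, negated to ORs, are spent as a level. The outer OR, negated to an AND,
  -- stays open for merging with a later AND; this is the saving that makes a stage cost three
  -- levels.
  choice→conj-not : w ≤ L → Choice d ℓ w p → Conj (suc d) ℓ (not ∘ p)
  choice→conj-not {w = w} {d = d} {p = p} w≤L c = record
    { cs = map negation alts ; ds = map gate alts
    ; cs≤ = ≤-trans (≤-reflexive (length-map negation alts)) alts≤
    ; ds≤ = ≤-trans (≤-reflexive (length-map gate alts)) alts≤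
    ; cs✓ = λ x → trans (none x alts) (cong not (alts✓ x))
    ; ds✓ = λ x → trans (some x alts) (trans (alts✓ x) (sym (not-involutive (p x))))
    }
    where
    open Choice c
    gate negation : ∃ (Conj d w) → Formula (suc d)
    gate (_ , a)     = Lit.pos (conj→lit w≤L a)
    negation (_ , a) = Lit.neg (conj→lit w≤L a)
    some : ∀ x as → any (eval x) (map gate as) ≡ any (λ a → proj₁ a x) as
    some x []       = refl
    some x (a ∷ as) = cong₂ _∨_ (Conj.cs✓ (proj₂ a) x) (some x as)
    none : ∀ x as → all (eval x) (map negation as) ≡ not (any (λ a → proj₁ a x) as)
    none x []       = refl
    none x (a ∷ as) = trans (cong₂ _∧_ (Conj.ds✓ (proj₂ a) x) (none x as)) (sym (deMorgan₂ (proj₁ a x) _))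

  -- N exceeds every value that is guessed; e bounds the number of guesses.
  module Guessing (d N ℓ₀ w₀ : ℕ) (N≤ℓ₀ : N ≤ ℓ₀) where

    -- `ℓ₀` bounds both the alternatives of one basic test and the range of one guess, so combining
    -- numbers adds exponents and each guess adds one more.
    record Number (e : ℕ) (v : Input → ℕ) : Set where
      field
        equals : ∀ c → Choice d (ℓ₀ ^ e) (e * w₀) (λ x → does (v x ≟ c))
    open Number

    number-cong : {u v : Input → ℕ} → (∀ x → u x ≡ v x) → Number e u → Number e v
    equals (number-cong h num) c = choice-cong (λ x → cong (λ z → does (z ≟ c)) (h x)) (equals num c)

    number-zero : Number 0 (const 0)
    equals number-zero zero    = conj→choice conj-true
    equals number-zero (suc c) = choice-false

    any-guess : (v : ℕ) (q : ℕ → Bool) → v < N → (∀ a → a ≢ v → q a ≡ false) → any q (upTo N) ≡ q v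
    any-guess v q v<N h = go (upTo N) (∈-upTo⁺ v<N)
      where
      nowhere : ∀ as → q v ≡ false → any q as ≡ false
      nowhere []       e = refl
      nowhere (a ∷ as) e with a ≟ v
      ... | yes refl rewrite e = nowhere as e
      ... | no a≢v   rewrite h a a≢v = nowhere as e
      go : ∀ as → v ∈ as → any q as ≡ q v
      go (a ∷ as) (here refl) with q a in e
      ... | true  = refl
      ... | false = nowhere as e
      go (a ∷ as) (there i) with a ≟ v
      ... | no a≢v rewrite h a a≢v = go as i
      ... | yes refl with q a in e
      ...   | true  = refl
      ...   | false = nowhere as e

    number-+ : ∀ {e₁ e₂} {u v : Input → ℕ} → (∀ x → u x < N) → Number e₁ u → Number e₂ v →
      Number (suc (e₁ + e₂)) (λ x → u x + v x)
    equals (number-+ {e₁} {e₂} {u} {v} u<N num₁ num₂) c =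
      choice-weaken len wid (choice-cong correct (choice-any test (upTo N) (λ a → choice-∧ (equals num₁ a) (rest a))))
      where
      complement : ℕ → Input → Bool
      complement a x = does (a + v x ≟ c)
      test : ℕ → Input → Bool
      test a x = does (u x ≟ a) ∧ complement a x
      rest : ∀ a → Choice d (ℓ₀ ^ e₂) (e₂ * w₀) (complement a)
      rest a with a ≤? c
      ... | yes a≤c = choice-cong (λ x → does-cong (v x ≟ c ∸ a) (a + v x ≟ c)
              (λ e → trans (cong (a +_) e) (m+[n∸m]≡n a≤c))
              (λ e → trans (sym (m+n∸m≡n a (v x))) (cong (_∸ a) e))) (equals num₂ (c ∸ a))
      ... | no a≰c = choice-cong (λ x → does-cong (no id) (a + v x ≟ c) ⊥-elim (λ e → a≰c (≤-trans (m≤m+n a (v x)) (≤-reflexive e)))) choice-false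
      correct : ∀ x → any (λ a → test a x) (upTo N) ≡ does (u x + v x ≟ c)
      correct x = trans (any-guess (u x) (λ a → test a x) (u<N x)
          (λ a a≢u → cong (_∧ complement a x) (does-cong (u x ≟ a) (no id) (λ e → a≢u (sym e)) ⊥-elim)))
        (cong (_∧ complement (u x) x) (does-cong (u x ≟ u x) (yes refl) id id))
      len : length (upTo N) * (ℓ₀ ^ e₁ * ℓ₀ ^ e₂) ≤ ℓ₀ ^ suc (e₁ + e₂)
      len = *-mono-≤ (≤-trans (≤-reflexive (length-upTo N)) N≤ℓ₀) (≤-reflexive (sym (^-distribˡ-+-* ℓ₀ e₁ e₂)))
      wid : e₁ * w₀ + e₂ * w₀ ≤ suc (e₁ + e₂) * w₀
      wid = ≤-trans (≤-reflexive (sym (*-distribʳ-+ w₀ e₁ e₂))) (m≤n+m _ w₀)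

    -- No guess is spent: 2v = c determines v, or is impossible for odd c.
    number-double : {v : Input → ℕ} → Number e v → Number e (λ x → 2 * v x)
    equals (number-double {v = v} num) c with c ≟ 2 * ⌊ c /2⌋
    ... | yes c-even = choice-cong (λ x → does-cong (v x ≟ ⌊ c /2⌋) (2 * v x ≟ c)
            (λ e → trans (cong (2 *_) e) (sym c-even))
            (λ e → *-cancelˡ-≡ _ _ 2 (trans e c-even))) (equals num ⌊ c /2⌋)
    ... | no c-odd = choice-cong (λ x → does-cong (no id) (2 * v x ≟ c) ⊥-elim
            (λ e → c-odd (trans (sym e) (cong (2 *_) (trans (n≡⌊n+n/2⌋ (v x)) (cong ⌊_/2⌋ (trans (sym (2*n≡n+n (v x))) e))))))) choice-false

    number-sum : (v : A → Input → ℕ) (as : List A) → All (λ a → Number e (v a)) as → (∀ x → sum (map (λ a → v a x) as) < N) →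
      Number (length as * suc e) (λ x → sum (map (λ a → v a x) as))
    number-sum v []       []           h = number-zero
    number-sum v (a ∷ as) (num ∷ nums) h =
      number-+ (λ x → ≤-<-trans (m≤m+n (v a x) _) (h x)) num (number-sum v as nums (λ x → ≤-<-trans (m≤n+m _ (v a x)) (h x)))

    number→choice : {v : Input → ℕ} (g : ℕ → Bool) → (∀ x → v x < N) → Number e v → Choice d (N * ℓ₀ ^ e) (e * w₀) (g ∘ v)
    number→choice {e = e} {v = v} g v<N num =
      choice-weaken (≤-reflexive (cong (_* ℓ₀ ^ e) (length-upTo N))) ≤-refl
        (choice-cong correct (choice-any test (upTo N) alt))
      where
      test : ℕ → Input → Bool
      test a x = g a ∧ does (v x ≟ a)
      alt : ∀ a → Choice d (ℓ₀ ^ e) (e * w₀) (test a)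
      alt a with g a
      ... | true  = equals num a
      ... | false = choice-false
      correct : ∀ x → any (λ a → test a x) (upTo N) ≡ g (v x)
      correct x = trans (any-guess (v x) (λ a → test a x) (v<N x)
          (λ a a≢v → trans (cong (g a ∧_) (does-cong (v x ≟ a) (no id) (λ e → a≢v (sym e)) ⊥-elim)) (∧-zeroʳ (g a))))
        (trans (cong (g (v x) ∧_) (does-cong (v x ≟ v x) (yes refl) id id)) (∧-identityʳ (g (v x))))

    -- Σ h(s a) is assembled from the population counts of the binary digits of h(s a).
    number-digits : (s : A → Input → ℕ) (as : List A) → length as < N →
      (∀ (φ : ℕ → Bool) → Number 1 (λ x → cnt (λ a → φ (s a x)) as)) →
      ∀ K (h : ℕ → ℕ) → (∀ i → h i < 2 ^ K) → Number (2 * K) (λ x → sum (map (λ a → h (s a x)) as))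
    number-digits s as as<N digit zero h h<1 = number-cong (λ x → sym (zeros x as)) number-zero
      where
      zeros : ∀ x as → sum (map (λ a → h (s a x)) as) ≡ 0
      zeros x []       = refl
      zeros x (a ∷ as) = cong₂ _+_ (n<1⇒n≡0 (h<1 (s a x))) (zeros x as)
    number-digits s as as<N digit (suc K) h h<2^K =
      subst (λ e → Number e (λ x → sum (map (λ a → h (s a x)) as))) (sym (l K))
        (number-cong (λ x → split x as)
          (number-+ (λ x → ≤-<-trans (cnt≤length _ as) as<N) (digit (odd ∘ h))
            (number-double (number-digits s as as<N digit K (⌊_/2⌋ ∘ h) (λ i → half< (h i) (h<2^K i))))))
      where
      l : ∀ K → 2 * suc K ≡ suc (1 + 2 * K)
      l = solve-∀
      odd : ℕ → Bool
      odd zero    = false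
      odd (suc i) = not (odd i)
      bit : Bool → ℕ
      bit b = if b then 1 else 0
      decompose : ∀ i → bit (odd i) + 2 * ⌊ i /2⌋ ≡ i
      decompose zero          = refl
      decompose (suc zero)    = refl
      decompose (suc (suc i)) rewrite not-involutive (odd i) = trans (l₁ (bit (odd i)) ⌊ i /2⌋) (cong (λ z → suc (suc z)) (decompose i))
        where
        l₁ : ∀ b k → b + 2 * suc k ≡ suc (suc (b + 2 * k))
        l₁ = solve-∀
      half< : ∀ i → i < 2 ^ suc K → ⌊ i /2⌋ < 2 ^ K
      half< i i< = *-cancelˡ-< 2 _ _ (≤-<-trans (≤-trans (m≤n+m _ (bit (odd i))) (≤-reflexive (decompose i))) i<)
      split : ∀ x as → cnt (λ a → odd (h (s a x))) as + 2 * sum (map (λ a → ⌊ h (s a x) /2⌋) as) ≡ sum (map (λ a → h (s a x)) as)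
      split x []       = refl
      split x (a ∷ as) = begin
        cnt (λ a → odd (h (s a x))) (a ∷ as) + 2 * (⌊ i /2⌋ + rest)   ≡⟨ cong (_+ 2 * (⌊ i /2⌋ + rest)) (head (odd i)) ⟩
        bit (odd i) + c + 2 * (⌊ i /2⌋ + rest)                       ≡⟨ l₂ (bit (odd i)) c ⌊ i /2⌋ rest ⟩
        (bit (odd i) + 2 * ⌊ i /2⌋) + (c + 2 * rest)                 ≡⟨ cong₂ _+_ (decompose i) (split x as) ⟩
        i + sum (map (λ a → h (s a x)) as)                           ∎
        where
        open ≡-Reasoning
        i c rest : ℕ
        i = h (s a x)
        c = cnt (λ a → odd (h (s a x))) as
        rest = sum (map (λ a → ⌊ h (s a x) /2⌋) as)
        head : ∀ b → (if b then suc c else c) ≡ bit b + c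
        head true  = refl
        head false = refl
        l₂ : ∀ b c k r → b + c + 2 * (k + r) ≡ (b + 2 * k) + (c + 2 * r)
        l₂ = solve-∀

-- Verifying a guessed count

all-map : {B : Set} (p : B → Bool) (f : A → B) (as : List A) → all p (map f as) ≡ all (p ∘ f) as
all-map p f []       = refl
all-map p f (a ∷ as) = cong (p (f a) ∧_) (all-map p f as)

all-does⇒All : {P : A → Set} (P? : ∀ a → Dec (P a)) → ∀ as → all (λ a → does (P? a)) as ≡ true → All P as
all-does⇒All P? []       e = []
all-does⇒All P? (a ∷ as) e with P? a
... | yes p = p ∷ all-does⇒All P? as e

All⇒all-does : {P : A → Set} (P? : ∀ a → Dec (P a)) → ∀ {as} → All P as → all (λ a → does (P? a)) as ≡ true
All⇒all-does P? []       = refl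
All⇒all-does P? {a ∷ as} (p ∷ ps) with P? a
... | yes _ = All⇒all-does P? ps
... | no ¬p = ⊥-elim (¬p p)

-- `lo` excludes v ≤ c - g. Separators test only from below, so v ≥ c + g is excluded by `up`
-- through the complementary count M - v. In the remaining window the residue test `re` is exact.
sandwich : ∀ v c M g {lo up re : Bool} → 0 < g → v ≤ M →
  (c ≤ v → lo ≡ true) → (v + g ≤ c → lo ≡ false) →
  (M ∸ c ≤ M ∸ v → up ≡ true) → (M ∸ v + g ≤ M ∸ c → up ≡ false) →
  (v ≡ c → re ≡ true) → (v ∸ c < g → c ∸ v < g → re ≡ true → v ≡ c) →
  (lo ∧ up) ∧ re ≡ does (v ≟ c)
sandwich v c M g {lo} {up} {re} 0<g v≤M lo⁺ lo⁻ up⁺ up⁻ re⁺ re⁻ = trans (go (v ≟ c) (v + g ≤? c) (c + g ≤? v)) (does-cong (v ≟ c) (v ≟ c) id id)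
  where
  complementary : c + g ≤ v → M ∸ v + g ≤ M ∸ c
  complementary h = m+n≤o⇒m≤o∸n (M ∸ v + g) (begin
    M ∸ v + g + c     ≡⟨ l (M ∸ v) g c ⟩
    M ∸ v + (c + g)   ≤⟨ +-monoʳ-≤ (M ∸ v) h ⟩
    M ∸ v + v         ≡⟨ m∸n+n≡m v≤M ⟩
    M                 ∎)
    where
    open ≤-Reasoning
    l : ∀ x y z → x + y + z ≡ x + (z + y)
    l = solve-∀
  ≰⇒∸< : ∀ a b → ¬ (b + g ≤ a) → a ∸ b < g
  ≰⇒∸< a b h = m<n+o⇒m∸n<o a b {{>-nonZero 0<g}} (≰⇒> h)
  go : (v≟c : Dec (v ≡ c)) → Dec (v + g ≤ c) → Dec (c + g ≤ v) → (lo ∧ up) ∧ re ≡ does v≟c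
  go (yes refl) _ _ = cong₂ _∧_ (cong₂ _∧_ (lo⁺ ≤-refl) (up⁺ ≤-refl)) (re⁺ refl)
  go (no _) (yes low) _ = cong (λ b → (b ∧ up) ∧ re) (lo⁻ low)
  go (no _) (no _) (yes high) = trans (cong (λ b → (lo ∧ b) ∧ re) (up⁻ (complementary high))) (cong (_∧ re) (∧-zeroʳ lo))
  go (no v≢c) (no ¬low) (no ¬high) = trans (cong ((lo ∧ up) ∧_) re≡false) (∧-zeroʳ (lo ∧ up))
    where
    re≡false : re ≡ false
    re≡false = ¬-not λ e → v≢c (re⁻ (≰⇒∸< v c ¬high) (≰⇒∸< c v ¬low) e)

copies : ℕ → List A → List A
copies c as = concat (replicate c as)

length-copies : ∀ c (as : List A) → length (copies c as) ≡ c * length as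
length-copies zero    as = refl
length-copies (suc c) as = trans (length-++ as) (cong (length as +_) (length-copies c as))

cnt-copies : (p : A → Bool) → ∀ c as → cnt p (copies c as) ≡ c * cnt p as
cnt-copies p zero    as = refl
cnt-copies p (suc c) as = trans (cnt-++ p as _) (cong (cnt p as +_) (cnt-copies p c as))

length-catMaybes : (as : List (Maybe A)) → length (catMaybes as) ≤ length as
length-catMaybes []             = z≤n
length-catMaybes (just _ ∷ as)  = s≤s (length-catMaybes as)
length-catMaybes (nothing ∷ as) = m≤n⇒m≤1+n (length-catMaybes as)

any-catMaybes : ∀ {M w} (y : Fin M → Bool) (as : List (Atom M w)) → any (allV y) (catMaybes as) ≡ any (acceptsAtom y) as
any-catMaybes y []             = refl
any-catMaybes y (just a ∷ as)  = cong (allV y a ∨_) (any-catMaybes y as)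
any-catMaybes y (nothing ∷ as) = any-catMaybes y as

-- For m = c·q, this lets a MOD gate of modulus m test divisibility by q once every wire is repeated
-- c times.
does-∣-scale : ∀ c q z .{{_ : NonZero (c * q)}} → does (c * q ∣? c * z) ≡ does (q ∣? z)
does-∣-scale c q z = does-cong (c * q ∣? c * z) (q ∣? z) (*-cancelˡ-∣ c {{m*n≢0⇒m≢0 c}}) (*-monoʳ-∣ c)

module Counting
  (n m L : ℕ) (qs : List ℕ) (uniq : Unique qs) (primes : All Prime qs) (m≡ : m ≡ product qs) where

  open Formulas n m L

  instance
    m≢0 : NonZero m
    m≢0 = subst NonZero (sym m≡) (productOfPrimes≢0 primes)

  q∣m : ∀ {q} → q ∈ qs → q ∣ m
  q∣m q∈ = subst (_ ∣_) (sym m≡) (∈⇒∣product q∈)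

  q≤m : ∀ {q} → q ∈ qs → q ≤ m
  q≤m q∈ = ∣⇒≤ (q∣m q∈)

  -- What a stage needs from below: monomials as arguments of the MOD gates, and, through `DNFsUpTo`
  -- one level higher, the two lower levels of the separators in both polarities.
  MonomialsUpTo : ℕ → ℕ → ∀ {M} → (Fin M → Input → Bool) → Set
  MonomialsUpTo D b {M} y = ∀ {k} → k ≤ b → (W : Vec (Fin M) k) → Σ (Formula D) λ φ → ∀ x → eval x φ ≡ allV (λ i → y i x) W

  DNFsUpTo : ℕ → ℕ → ℕ → ∀ {M} → (Fin M → Input → Bool) → Set
  DNFsUpTo D w K̄ {M} y = (Ws : List (Vec (Fin M) w)) → length Ws ≤ K̄ → Lit D (λ x → any (allV (λ i → y i x)) Ws)

  module Residues (D t M : ℕ) (y : Fin M → Input → Bool) (monomial : MonomialsUpTo D (m * t) y)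
    (fits : m * (suc M ^ (m * t) + 2 * m) ≤ L) where

    v : Input → ℕ
    v x = cnt (λ i → y i x) (allFin M)

    length-allFin : length (allFin M) ≡ M
    length-allFin = length-tabulate {n = M} id

    test-formula : ∀ {q} → q ∈ qs → ∀ {k} → k ≤ m * t → ∀ s → s ≤ 2 * m →
      Σ (Formula (suc D)) λ φ → ∀ x → eval x φ ≡ does (q ∣? binom (v x) k + s)
    test-formula {q} q∈ {k} k≤ s s≤ with q∣m q∈
    ... | divides c m≡cq = mod wires fits′ , correct
      where
      monomials once wires : List (Formula D)
      monomials = map (proj₁ ∘ monomial k≤) (combos k (allFin M))
      -- The empty monomial is constantly true, so `s` copies of it add the shift.
      once = monomials ++ replicate s (proj₁ (monomial z≤n []))
      wires = copies c once
      c≤m : c ≤ m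
      c≤m = ∣⇒≤ (divides q (trans m≡cq (*-comm c q)))
      fits′ : length wires ≤ L
      fits′ = begin
        length wires                          ≡⟨ length-copies c once ⟩
        c * length once                       ≡⟨ cong (c *_) (length-++ monomials) ⟩
        c * (length monomials + length (replicate s (proj₁ (monomial z≤n [])))) ≡⟨ cong₂ (λ a b → c * (a + b)) (length-map (proj₁ ∘ monomial k≤) (combos k (allFin M))) (length-replicate s) ⟩
        c * (length (combos k (allFin M)) + s) ≤⟨ *-mono-≤ c≤m (+-mono-≤ (≤-trans (length-combos k (allFin M)) (≤-trans (≤-reflexive (cong (λ z → suc z ^ k) length-allFin)) (^-monoʳ-≤ (suc M) k≤))) s≤) ⟩
        m * (suc M ^ (m * t) + 2 * m)         ≤⟨ fits ⟩
        L                                     ∎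
        where open ≤-Reasoning
      count : ∀ x → cnt (eval x) once ≡ binom (v x) k + s
      count x = begin
        cnt (eval x) once                     ≡⟨ cnt-++ (eval x) monomials _ ⟩
        cnt (eval x) monomials + cnt (eval x) (replicate s _) ≡⟨ cong₂ _+_
            (trans (cnt-map (eval x) (proj₁ ∘ monomial k≤) (combos k (allFin M)))
              (trans (cnt-cong (λ W → proj₂ (monomial k≤ W) x) (combos k (allFin M))) (cnt-combos (λ i → y i x) k (allFin M))))
            (trans (cnt-replicate (eval x) s _) (cong (if_then s else 0) (proj₂ (monomial z≤n []) x))) ⟩
        binom (v x) k + s                     ∎
        where open ≡-Reasoning
      correct : ∀ x → does (m ∣? cnt (eval x) wires) ≡ does (q ∣? binom (v x) k + s)
      correct x = begin
        does (m ∣? cnt (eval x) wires)                 ≡⟨ cong (λ z → does (m ∣? z)) (trans (cnt-copies (eval x) c once) (cong (c *_) (count x))) ⟩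
        does (m ∣? c * (binom (v x) k + s))            ≡⟨ cong (λ z → does (z ∣? c * (binom (v x) k + s))) m≡cq ⟩
        does (c * q ∣? c * (binom (v x) k + s))        ≡⟨ does-∣-scale c q _ {{subst NonZero m≡cq m≢0}} ⟩
        does (q ∣? binom (v x) k + s)                  ∎
        where open ≡-Reasoning

    test-conj : ∀ {q} → Prime q → q ∈ qs → ∀ {k} → k ≤ m * t → ∀ s → s ≤ q →
      Conj (suc D) m (λ x → does (q ∣? binom (v x) k + s))
    test-conj {q} pr q∈ {k} k≤ s s≤q = record
      { cs = formula 0 z≤n ∷ []
      ; ds = others js (All.tabulate λ {j} j∈ → j≤ j∈)
      ; cs≤ = >-nonZero⁻¹ m
      ; ds≤ = ≤-trans (≤-reflexive (trans (length-others js _) (trans (length-map suc (upTo (pred q))) (length-upTo (pred q))))) (≤-trans pred[n]≤n (q≤m q∈))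
      ; cs✓ = λ x → trans (∧-identityʳ _) (trans (formula✓ 0 z≤n x) (cong (λ z → does (q ∣? z)) (+-identityʳ _)))
      ; ds✓ = λ x → trans (any-others js _ x) (sym (not-∣? q (binom (v x) k + s)))
      }
      where
      instance
        _ = prime⇒nonZero pr
      js : List ℕ
      js = map suc (upTo (pred q))
      j≤ : ∀ {j} → j ∈ js → j ≤ m
      j≤ j∈ with ∈-map⁻ suc j∈
      ... | i , i∈ , refl = ≤-trans (∈-upTo⁻ i∈) (≤-trans pred[n]≤n (q≤m q∈))
      s+j≤ : ∀ {j} → j ≤ m → s + j ≤ 2 * m
      s+j≤ j≤m = ≤-trans (+-mono-≤ (≤-trans s≤q (q≤m q∈)) j≤m) (≤-reflexive (sym (2*n≡n+n m)))
      formula : ∀ j → j ≤ m → Formula (suc D)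
      formula j j≤m = proj₁ (test-formula q∈ k≤ (s + j) (s+j≤ j≤m))
      formula✓ : ∀ j (j≤m : j ≤ m) x → eval x (formula j j≤m) ≡ does (q ∣? binom (v x) k + s + j)
      formula✓ j j≤m x = trans (proj₂ (test-formula q∈ k≤ (s + j) (s+j≤ j≤m)) x) (cong (λ z → does (q ∣? z)) (sym (+-assoc (binom (v x) k) s j)))
      others : ∀ js → All (_≤ m) js → List (Formula (suc D))
      others []       []       = []
      others (j ∷ js) (h ∷ hs) = formula j h ∷ others js hs
      length-others : ∀ js hs → length (others js hs) ≡ length js
      length-others []       []       = refl
      length-others (j ∷ js) (h ∷ hs) = cong suc (length-others js hs)
      any-others : ∀ js hs x → any (eval x) (others js hs) ≡ any (λ j → does (q ∣? binom (v x) k + s + j)) js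
      any-others []       []       x = refl
      any-others (j ∷ js) (h ∷ hs) x = cong₂ _∨_ (formula✓ j h x) (any-others js hs x)

  module Approximation (D w K̄ M : ℕ) (y : Fin M → Input → Bool) (dnf : DNFsUpTo (suc D) w K̄ y) where

    -- The top OR of the separator becomes the list of alternatives, its AND a conjunction, and its
    -- lower OR and AND a single literal. Atoms that never accept drop out of the OR.
    approximation : ∀ {g c K B} → K ≤ K̄ → (S : Separator M w g c K B) →
      Choice (suc D) (suc M) B (λ x → accepts (λ i → y i x) (Separator.seed S))
    approximation {K = K} {B} K≤ S =
      choice-weaken (≤-reflexive (trans (*-identityʳ _) (length-toList seed))) ≤-refl
        (choice-any rowTest (toList seed) (λ row → conj→choice (conj-weaken (≤-reflexive (trans (*-identityʳ _) (length-toList row)))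
          (conj-all entryTest (toList row) (All.tabulate λ {a} _ → lit→conj (entry a))))))
      where
      open Separator S
      entryTest : Vec (Atom M w) K → Input → Bool
      entryTest a x = anyV (acceptsAtom (λ i → y i x)) a
      rowTest : Vec (Vec (Atom M w) K) B → Input → Bool
      rowTest row x = allV (λ a → entryTest a x) row
      entry : ∀ a → Lit (suc D) (entryTest a)
      entry a = lit-cong (λ x → any-catMaybes (λ i → y i x) (toList a))
        (dnf (catMaybes (toList a)) (≤-trans (length-catMaybes (toList a)) (≤-trans (≤-reflexive (length-toList a)) K≤)))

  module Exact (D t w K̄ B̄ ζ M : ℕ) (y : Fin M → Input → Bool)
    (monomial : MonomialsUpTo D (m * t) y)
    (dnf⁺ : DNFsUpTo (suc D) w K̄ y) (dnf⁻ : DNFsUpTo (suc D) w K̄ (λ i x → not (y i x)))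
    (fits : m * (suc M ^ (m * t) + 2 * m) ≤ L)
    (0<t : 0 < t) (0<w : 0 < w) (M≤ : M ≤ w * t ^ length qs * t) (Z≤ : 4 * (2 * M + 1) ≤ 2 ^ ζ)
    (K≤ : suc (2 * M ^ w) * ζ ≤ K̄) (B≤ : 2 ^ suc (8 * ζ * t) * (2 * M + 1) ≤ B̄) where

    open Residues D t M y monomial fits

    g : ℕ
    g = t ^ length qs

    0<g : 0 < g
    0<g = ^-positive t (length qs) 0<t

    record Threshold (z : Fin M → Input → Bool) (c : ℕ) : Set where
      field
        test     : Input → Bool
        choice   : Choice (suc D) (suc M) B̄ test
        complete : ∀ x → c ≤ cnt (λ i → z i x) (allFin M) → test x ≡ true
        sound    : ∀ x → cnt (λ i → z i x) (allFin M) + g ≤ c → test x ≡ false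

    threshold : ∀ z → DNFsUpTo (suc D) w K̄ z → ∀ c → c ≤ M → Threshold z c
    threshold z dnf c c≤M with g ≤? c
    -- If c < g, no count is as low as c - g, so nothing has to be rejected.
    ... | no g≰c = record
      { test = const true ; choice = choice-weaken (s≤s z≤n) z≤n (conj→choice conj-true)
      ; complete = λ _ _ → refl ; sound = λ x h → ⊥-elim (g≰c (≤-trans (m≤n+m g _) h)) }
    ... | yes g≤c with separator M w t g c ζ 0<w 0<g g≤c c≤M M≤ Z≤
    ...   | K , B , K≤′ , B≤′ , S = record
      { test = λ x → accepts (λ i → z i x) (Separator.seed S)
      ; choice = choice-weaken ≤-refl (≤-trans B≤′ B≤) (Approximation.approximation D w K̄ M z dnf (≤-trans K≤′ K≤) S)
      ; complete = λ x → Separator.complete S (λ i → z i x)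
      ; sound = λ x → Separator.sound S (λ i → z i x) }

    residue : ∀ c → Σ (Input → Bool) λ p → Conj (suc D) (length qs * (m * t) * m) p ×
      (∀ x → v x ≡ c → p x ≡ true) × (∀ x → v x ∸ c < g → c ∸ v x < g → p x ≡ true → v x ≡ c)
    residue c = p , conj-weaken (*-monoˡ-≤ m length≤) (conj-all pass tests (All.map conj valid))
      , (λ x e → All⇒all-does (pass? x) (All.map (λ {τ} h → subst (λ z → Pass z τ) (sym e) (proj₂ (proj₂ (proj₂ (proj₂ h))))) valid))
      , (λ x h₁ h₂ e → tests-separate R (v x) (all-does⇒All (pass? x) tests e) h₁ h₂)
      where
      R : ResidueTests m t c qs
      R = residueTests m t c qs 0<t uniq primes (All.tabulate q≤m)
      open ResidueTests R
      pass? : ∀ x τ → Dec (Pass (v x) τ)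
      pass? x (q , k , s) = q ∣? binom (v x) k + s
      pass : Test → Input → Bool
      pass τ x = does (pass? x τ)
      p : Input → Bool
      p x = all (λ τ → pass τ x) tests
      conj : ∀ {τ} → Prime (proj₁ τ) × proj₁ τ ∈ qs × proj₁ (proj₂ τ) ≤ m * t × proj₂ (proj₂ τ) ≤ proj₁ τ × Pass c τ →
        Conj (suc D) m (pass τ)
      conj {q , k , s} (pr , q∈ , k≤ , s≤ , _) = test-conj pr q∈ k≤ s s≤

    exact : ∀ c → Choice (suc D) (suc M * suc M) (B̄ + B̄ + length qs * (m * t) * m) (λ x → does (v x ≟ c))
    exact c with c ≤? M
    ... | no c≰M = choice-cong (λ x → does-cong (no id) (v x ≟ c) ⊥-elim
            (λ e → c≰M (≤-trans (≤-reflexive (sym e)) (≤-trans (cnt≤length _ (allFin M)) (≤-reflexive length-allFin))))) choice-false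
    ... | yes c≤M = choice-weaken (≤-reflexive (*-identityʳ _)) ≤-refl (choice-cong correct
            (choice-∧ (choice-∧ (Threshold.choice lower) (Threshold.choice upper)) (conj→choice (proj₁ (proj₂ res)))))
      where
      lower : Threshold y c
      lower = threshold y dnf⁺ c c≤M
      upper : Threshold (λ i x → not (y i x)) (M ∸ c)
      upper = threshold (λ i x → not (y i x)) dnf⁻ (M ∸ c) (m∸n≤m M c)
      res = residue c
      module Lo = Threshold lower
      module Up = Threshold upper
      v̄ : Input → ℕ
      v̄ x = cnt (λ i → not (y i x)) (allFin M)
      v̄≡ : ∀ x → v̄ x ≡ M ∸ v x
      v̄≡ x = trans (cnt-not (λ i → y i x) (allFin M)) (cong (_∸ v x) length-allFin)
      v≤M : ∀ x → v x ≤ M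
      v≤M x = ≤-trans (cnt≤length _ (allFin M)) (≤-reflexive length-allFin)
      correct : ∀ x → (Lo.test x ∧ Up.test x) ∧ proj₁ res x ≡ does (v x ≟ c)
      correct x = sandwich (v x) c M g 0<g (v≤M x) (Lo.complete x) (Lo.sound x)
        (λ h → Up.complete x (subst (M ∸ c ≤_) (sym (v̄≡ x)) h))
        (λ h → Up.sound x (subst (λ z → z + g ≤ M ∸ c) (sym (v̄≡ x)) h))
        (proj₁ (proj₂ (proj₂ res)) x) (proj₂ (proj₂ (proj₂ res)) x)

-- Stages

chunks : ∀ a b (xs : List A) → length xs ≤ a * b → ∃ λ zs → concat zs ≡ xs × length zs ≤ a × All (λ z → length z ≤ b) zs
chunks zero    b []       h = [] , refl , z≤n , []
chunks (suc a) b xs h with chunks a b (drop b xs) (≤-trans (≤-reflexive (length-drop b xs)) (m≤n+o⇒m∸n≤o (length xs) b h))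
... | zs , eq , len , small = take b xs ∷ zs , trans (cong (take b xs ++_) eq) (take++drop≡id b xs) , s≤s len
                            , ≤-trans (≤-reflexive (length-take b xs)) (m⊓n≤m b _) ∷ small

cnt-concat : (p : A → Bool) (zs : List (List A)) → cnt p (concat zs) ≡ sum (map (cnt p) zs)
cnt-concat p []       = refl
cnt-concat p (z ∷ zs) = trans (cnt-++ p z (concat zs)) (cong (cnt p z +_) (cnt-concat p zs))

cnt-lookup : (p : A → Bool) (as : List A) → cnt p as ≡ cnt (p ∘ lookup as) (allFin (length as))
cnt-lookup p as = begin
  cnt p as                                 ≡⟨ cong (cnt p) (tabulate-lookup as) ⟨
  cnt p (tabulate (lookup as))             ≡⟨ cong (cnt p) (map-tabulate id (lookup as)) ⟨
  cnt p (map (lookup as) (allFin (length as))) ≡⟨ cnt-map p (lookup as) (allFin (length as)) ⟩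
  cnt (p ∘ lookup as) (allFin (length as)) ∎
  where open ≡-Reasoning

sum-map-cong∈ : (f g : A → ℕ) (as : List A) → (∀ {a} → a ∈ as → f a ≡ g a) → sum (map f as) ≡ sum (map g as)
sum-map-cong∈ f g []       h = refl
sum-map-cong∈ f g (a ∷ as) h = cong₂ _+_ (h (here refl)) (sum-map-cong∈ f g as (h ∘ there))

-- The hypotheses gather every numerical demand, separating construction from estimates. `K̄` bounds
-- the atoms of an OR, `B̄` the ORs of an AND, `ℓ₀` and `w₀` the alternatives and the width of one
-- exact test, and `ℓ` the alternatives of a whole stage.
module Stages
  (n m L : ℕ) (qs : List ℕ) (uniq : Unique qs) (primes : All Prime qs) (m≡ : m ≡ product qs)
  (t ζ K̄ B̄ N ℓ₀ w₀ K ℓ : ℕ)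
  (0<t : 0 < t)
  (fits : m * (suc (t * t ^ length qs * t) ^ (m * t) + 2 * m) ≤ L)
  (Z≤ : 4 * (2 * (t * t ^ length qs * t) + 1) ≤ 2 ^ ζ)
  (K≤ : suc (2 * (t * t ^ length qs * t) ^ t) * ζ ≤ K̄) (K̄≤L : K̄ ≤ L)
  (B≤ : 2 ^ suc (8 * ζ * t) * (2 * (t * t ^ length qs * t) + 1) ≤ B̄)
  (w₀≥ : B̄ + B̄ + length qs * (m * t) * m ≤ w₀)
  (ℓ₀≥ : suc (t * t ^ length qs * t) * suc (t * t ^ length qs * t) ≤ ℓ₀) (N≤ℓ₀ : N ≤ ℓ₀)
  (J<N : t * t ^ length qs * t < N) (2^K≤N : 2 ^ K ≤ N)
  (guesses≤L : t * suc (2 * K) * w₀ ≤ L)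
  (ℓ≥ : N * ℓ₀ ^ (t * suc (2 * K)) ≤ ℓ)
  (0<K : 0 < K)
  (mtℓ≤L : m * t * ℓ ≤ L) (mt≤L : m * t ≤ L) where

  private
    r J : ℕ
    r = length qs
    J = t * t ^ r * t

  open Formulas n m L
  open Counting n m L qs uniq primes m≡

  -- Stated for `not` of a predicate because that is what `choice→conj-not` delivers; quantifying
  -- over all predicates absorbs the negation.
  Counts : ℕ → ℕ → Set
  Counts d E = (xs : List (Fin n)) → length xs ≤ E → (g : ℕ → Bool) → Conj d ℓ (λ x → not (g (cnt x xs)))

  module _ (D : ℕ) where
    open Guessing (suc D) N ℓ₀ w₀ N≤ℓ₀

    0<J : 0 < J
    0<J = *-mono-≤ (*-mono-≤ 0<t (^-positive t r 0<t)) 0<t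

    digit : ∀ w → 0 < w → w ≤ t → ∀ M → M ≤ w * t ^ r * t → (y : Fin M → Input → Bool) →
      MonomialsUpTo D (m * t) y → DNFsUpTo (suc D) w K̄ y → DNFsUpTo (suc D) w K̄ (λ i x → not (y i x)) →
      Number 1 (λ x → cnt (λ i → y i x) (allFin M))
    digit w 0<w w≤t M M≤ y mono dnf⁺ dnf⁻ = record { equals = λ c → choice-weaken
        (≤-trans (*-mono-≤ (s≤s M≤J) (s≤s M≤J)) (≤-trans ℓ₀≥ (≤-reflexive (sym (*-identityʳ ℓ₀)))))
        (≤-trans w₀≥ (≤-reflexive (sym (+-identityʳ w₀))))
        (Exact.exact D t w K̄ B̄ ζ M y mono dnf⁺ dnf⁻
          (≤-trans (*-monoʳ-≤ m (+-monoˡ-≤ (2 * m) (^-monoˡ-≤ (m * t) (s≤s M≤J)))) fits)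
          0<t 0<w M≤
          (≤-trans (*-monoʳ-≤ 4 (+-monoˡ-≤ 1 (*-monoʳ-≤ 2 M≤J))) Z≤)
          (≤-trans (*-monoˡ-≤ ζ (s≤s (*-monoʳ-≤ 2 (≤-trans (^-monoˡ-≤ w M≤J) (^-monoʳ-≤ J {{>-nonZero 0<J}} w≤t))))) K≤)
          (≤-trans (*-monoʳ-≤ (2 ^ suc (8 * ζ * t)) (+-monoˡ-≤ 1 (*-monoʳ-≤ 2 M≤J))) B≤) c) }
      where
      M≤J : M ≤ J
      M≤J = ≤-trans M≤ (*-monoˡ-≤ t (*-monoˡ-≤ (t ^ r) w≤t))

    blocks→counts : ∀ e S → t * S < N → e ≤ 2 * K →
      ((z : List (Fin n)) → length z ≤ S → Number e (λ x → cnt x z)) → Counts (suc (suc D)) (t * S)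
    blocks→counts e S tS<N e≤ number xs xs≤ g with chunks t S xs xs≤
    ... | zs , refl , zs≤t , small = conj-weaken ℓ-bound
        (choice→conj-not w-bound (number→choice g (λ x → <N x (concat zs) xs≤)
          (number-cong (λ x → sym (cnt-concat x zs))
            (number-sum (λ z x → cnt x z) zs (All.map (λ {z} → number z) small)
              (λ x → subst (_< N) (cnt-concat x zs) (<N x (concat zs) xs≤))))))
      where
      <N : ∀ x (xs : List (Fin n)) → length xs ≤ t * S → cnt x xs < N
      <N x xs h = ≤-<-trans (cnt≤length x xs) (≤-<-trans h tS<N)
      e-bound : length zs * suc e ≤ t * suc (2 * K)
      e-bound = *-mono-≤ zs≤t (s≤s e≤)
      w-bound : length zs * suc e * w₀ ≤ L
      w-bound = ≤-trans (*-monoˡ-≤ w₀ e-bound) guesses≤L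
      ℓ-bound : N * ℓ₀ ^ (length zs * suc e) ≤ ℓ
      ℓ-bound = ≤-trans (*-monoʳ-≤ N (^-monoʳ-≤ ℓ₀ {{>-nonZero (≤-trans (s≤s z≤n) ℓ₀≥)}} e-bound)) ℓ≥

  literal : ∀ {d E} → Counts d E → ∀ z → length z ≤ E → ∀ φ → Conj d ℓ (λ x → φ (cnt x z))
  literal C z z≤ φ = conj-cong (λ x → not-involutive (φ (cnt x z))) (C z z≤ (not ∘ φ))

  base : t * (1 * t ^ r * t) < N → Counts 3 (t * (1 * t ^ r * t))
  base tS<N = blocks→counts 1 1 (1 * t ^ r * t) tS<N (≤-trans 0<K (m≤m+n K _)) number
    where
    open Guessing 2 N ℓ₀ w₀ N≤ℓ₀
    number : (z : List (Fin n)) → length z ≤ 1 * t ^ r * t → Number 1 (λ x → cnt x z)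
    number z z≤ = number-cong (λ x → sym (cnt-lookup x z))
      (digit 1 1 (s≤s z≤n) 0<t (length z) z≤ (λ i x → x (lookup z i)) mono dnf⁺ dnf⁻)
      where
      vars : List (Fin (length z)) → List (Formula 0)
      vars = map (var ∘ lookup z)
      mono : MonomialsUpTo 1 (m * t) (λ i x → x (lookup z i))
      mono k≤ W = and (vars (toList W)) (≤-trans (≤-reflexive (trans (length-map _ (toList W)) (length-toList W))) (≤-trans k≤ mt≤L))
                , λ x → all-map (eval x) (var ∘ lookup z) (toList W)
      firsts : List (Vec (Fin (length z)) 1) → List (Formula 0)
      firsts Ws = vars (map Vec.head Ws)
      firsts≤ : ∀ Ws → length Ws ≤ K̄ → length (firsts Ws) ≤ L
      firsts≤ Ws h = ≤-trans (≤-reflexive (trans (length-map _ (map Vec.head Ws)) (length-map Vec.head Ws))) (≤-trans h K̄≤L)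
      dnf⁺ : DNFsUpTo 2 1 K̄ (λ i x → x (lookup z i))
      dnf⁺ Ws h = lit-cong (λ x → same x Ws) (lit-lift (or (firsts Ws) (firsts≤ Ws h)))
        where
        same : ∀ x Ws → any (eval x) (firsts Ws) ≡ any (allV (λ i → x (lookup z i))) Ws
        same x []             = refl
        same x ((i ∷ []) ∷ Ws) = cong₂ _∨_ (sym (∧-identityʳ _)) (same x Ws)
      -- With w = 1 an OR of negated inputs is a NOT above one AND of inputs, which fits into levels
      -- 1 and 2.
      dnf⁻ : DNFsUpTo 2 1 K̄ (λ i x → not (x (lookup z i)))
      dnf⁻ Ws h = lit-cong (λ x → same x Ws) (lit-not (lit-lift (and (firsts Ws) (firsts≤ Ws h))))
        where
        same : ∀ x Ws → not (all (eval x) (firsts Ws)) ≡ any (allV (λ i → not (x (lookup z i)))) Ws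
        same x []             = refl
        same x ((i ∷ []) ∷ Ws) = trans (deMorgan₁ (x (lookup z i)) _) (cong₂ _∨_ (sym (∧-identityʳ _)) (same x Ws))

  -- Level d + 1 holds the ANDs merged with the open conjunctions from below, level d + 2 the MOD
  -- gates and the ORs of the separators, level d + 3 the verification of a guess. The OR over
  -- guesses stays open for the next stage.
  step : ∀ {d E} → Counts d E → E < 2 ^ K → t * (J * E) < N → Counts (3 + d) (t * (J * E))
  step {d} {E} C E<2^K tS<N = blocks→counts (suc d) (2 * K) (J * E) tS<N ≤-refl number
    where
    open Guessing (suc (suc d)) N ℓ₀ w₀ N≤ℓ₀
    module Population (gs : List (List (Fin n))) (small : All (λ z → length z ≤ E) gs) (φ : ℕ → Bool) where
      y : Fin (length gs) → Input → Bool
      y i x = φ (cnt x (lookup gs i))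
      conjunction : ∀ {k} → k ≤ m * t → (W : Vec (Fin (length gs)) k) → Lit (suc d) (λ x → allV (λ i → y i x) W)
      conjunction k≤ W = conj→lit (≤-trans (≤-reflexive (cong (_* ℓ) (length-toList W))) (≤-trans (*-monoˡ-≤ ℓ k≤) mtℓ≤L))
        (conj-all y (toList W) (All.tabulate λ {i} _ → literal C (lookup gs i) (All.lookup small (∈-lookup {xs = gs} i)) φ))
      mono : MonomialsUpTo (suc d) (m * t) y
      mono k≤ W = Lit.pos (conjunction k≤ W) , Lit.pos✓ (conjunction k≤ W)
      dnf : DNFsUpTo (suc (suc d)) t K̄ y
      dnf Ws h = lit-cong (λ x → sym (any-not-all (allV (λ i → y i x)) Ws))
        (lit-not (conj→lit (≤-trans (≤-reflexive (*-identityʳ _)) (≤-trans h K̄≤L))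
          (conj-all (λ W x → not (allV (λ i → y i x) W)) Ws
            (All.tabulate λ {W} _ → lit→conj (lit-not (conjunction (≤-trans (≤-reflexive (sym (*-identityˡ t))) (*-monoˡ-≤ t (>-nonZero⁻¹ m))) W))))))
    digits : ∀ gs → length gs ≤ J → All (λ z → length z ≤ E) gs → ∀ φ → Number 1 (λ x → cnt (λ z → φ (cnt x z)) gs)
    digits gs gs≤ small φ = number-cong (λ x → sym (cnt-lookup (λ z → φ (cnt x z)) gs))
      (digit (suc d) t 0<t ≤-refl (length gs) gs≤ P.y P.mono P.dnf
        (Population.dnf gs small (not ∘ φ)))
      where module P = Population gs small φ
    number : (z : List (Fin n)) → length z ≤ J * E → Number (2 * K) (λ x → cnt x z)
    number z z≤ with chunks J E z z≤
    ... | gs , refl , gs≤ , small = number-cong capped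
        -- Digit extraction wants a function below 2^K everywhere; capping at `E` provides it
        -- without changing any block's count.
        (number-digits (λ z x → cnt x z) gs (≤-<-trans gs≤ J<N) (digits gs gs≤ small) K (_⊓ E) (λ i → ≤-<-trans (m⊓n≤n i E) E<2^K))
      where
      capped : ∀ x → sum (map (λ z → cnt x z ⊓ E) gs) ≡ cnt x (concat gs)
      capped x = trans (sum-map-cong∈ _ (cnt x) gs (λ {z} z∈ → m≤n⇒m⊓n≡m (≤-trans (cnt≤length x z) (All.lookup small z∈)))) (sym (cnt-concat x gs))

  extent : ℕ → ℕ
  extent zero    = t * (1 * t ^ r * t)
  extent (suc k) = t * (J * extent k)

  counts : ∀ k → (∀ j → j ≤ k → extent j < 2 ^ K) → Counts (3 * suc k) (extent k)
  counts zero    small = base (≤-trans (small 0 ≤-refl) 2^K≤N)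
  counts (suc k) small = subst (λ d → Counts d (extent (suc k))) (l k)
    (step (counts k (λ j j≤k → small j (m≤n⇒m≤1+n j≤k))) (small k (n≤1+n k)) (≤-trans (small (suc k) ≤-refl) 2^K≤N))
    where
    l : ∀ k → 3 + 3 * suc k ≡ 3 * suc (suc k)
    l = solve-∀

-- From formulas to circuits

module Compile (n m L D : ℕ) where

  open Formulas n m L

  private variable
    k k′ k″ d : ℕ

  value : Circuit n k → Input → Src n k → Bool
  value c x = srcVal x (evalAll m c x)

  height : Circuit n k → Src n k → ℕ
  height c = srcDepth (depthAll c)

  -- Gates are addressed backwards from the newest one, so each added gate shifts all earlier
  -- sources; the embedding translates them and preserves their values and depths.
  record Embeds (c : Circuit n k) (c′ : Circuit n k′) : Set where
    field
      emb     : Src n k → Src n k′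
      value≡  : ∀ x s → value c′ x (emb s) ≡ value c x s
      height≡ : ∀ s → height c′ (emb s) ≡ height c s

  embeds-refl : {c : Circuit n k} → Embeds c c
  embeds-refl = record { emb = id ; value≡ = λ _ _ → refl ; height≡ = λ _ → refl }

  embeds-trans : {c : Circuit n k} {c′ : Circuit n k′} {c″ : Circuit n k″} → Embeds c c′ → Embeds c′ c″ → Embeds c c″
  embeds-trans e f = record
    { emb = F.emb ∘ E.emb
    ; value≡ = λ x s → trans (F.value≡ x (E.emb s)) (E.value≡ x s)
    ; height≡ = λ s → trans (F.height≡ (E.emb s)) (E.height≡ s) }
    where
    module E = Embeds e
    module F = Embeds f

  embeds-▷ : (c : Circuit n k) (g : Gate n k) → Embeds c (c ▷ g)
  embeds-▷ {k} c g = record { emb = emb ; value≡ = value≡ ; height≡ = height≡ }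
    where
    emb : Src n k → Src n (suc k)
    emb (inj₁ i) = inj₁ i
    emb (inj₂ j) = inj₂ (suc j)
    value≡ : ∀ x s → value (c ▷ g) x (emb s) ≡ value c x s
    value≡ x (inj₁ i) = refl
    value≡ x (inj₂ j) = refl
    height≡ : ∀ s → height (c ▷ g) (emb s) ≡ height c s
    height≡ (inj₁ i) = refl
    height≡ (inj₂ j) = refl

  -- The factor `suc L` instead of `L` leaves room for the single argument of `negate` and `lift`
  -- even when `L` is 0.
  gates : ℕ → ℕ
  gates zero    = 0
  gates (suc d) = suc (suc L * gates d)

  gates< : ∀ d → suc (gates d) ≤ (2 + L) ^ d
  gates< zero    = ≤-refl
  gates< (suc d) = ≤-trans (≤-trans (m≤m+n (2 + suc L * gates d) (gates d + L)) (≤-reflexive (l L (gates d)))) (*-monoʳ-≤ (2 + L) (gates< d))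
    where
    l : ∀ L g → 2 + suc L * g + (g + L) ≡ (2 + L) * suc g
    l = solve-∀

  record Extended (c : Circuit n k) (added : ℕ) : Set where
    field
      {size}  : ℕ
      circuit : Circuit n size
      embeds  : Embeds c circuit
      depth≤  : depth circuit ≤ D
      size≤   : size ≤ k + added

  record Compiled (c : Circuit n k) (φ : Formula d) : Set where
    field
      extended : Extended c (gates d)
    open Extended extended public
    field
      src     : Src n size
      src✓    : ∀ x → value circuit x src ≡ eval x φ
      height≤ : height circuit src ≤ d

  record CompiledList (c : Circuit n k) (φs : List (Formula d)) : Set where
    field
      extended : Extended c (length φs * gates d)
    open Extended extended public
    field
      srcs     : List (Src n size)
      srcs✓    : ∀ x → map (value circuit x) srcs ≡ map (eval x) φs
      heights≤ : All (λ s → height circuit s ≤ d) srcs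

  maxL≤ : {ns : List ℕ} → All (_≤ d) ns → maxL ns ≤ d
  maxL≤ []       = z≤n
  maxL≤ (h ∷ hs) = ⊔-lub h (maxL≤ hs)

  add-gate : {c : Circuit n k} {φ : Formula (suc d)} → ∀ {a} (E : Extended c a) → suc a ≤ gates (suc d) → (g : Gate n (Extended.size E)) →
    (∀ x → gateVal m x (evalAll m (Extended.circuit E) x) g ≡ eval x φ) → gateDepth (depthAll (Extended.circuit E)) g ≤ suc d → suc d ≤ D →
    Compiled c φ
  add-gate {k = k} {a = a} E fits g ok low d<D = record
    { extended = record
      { circuit = circuit ▷ g ; embeds = embeds-trans embeds (embeds-▷ circuit g)
      ; depth≤ = ⊔-lub (≤-trans low d<D) depth≤
      ; size≤ = ≤-trans (s≤s size≤) (≤-trans (≤-reflexive (sym (+-suc k a))) (+-monoʳ-≤ k fits)) }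
    ; src = inj₂ zero ; src✓ = ok ; height≤ = low }
    where open Extended E

  list-fits : ∀ {A : Set} (φs : List A) d → length φs ≤ L → suc (length φs * gates d) ≤ gates (suc d)
  list-fits φs d h = s≤s (*-monoˡ-≤ (gates d) (m≤n⇒m≤1+n h))

  mutual
    compile : ∀ {d} (φ : Formula d) → d ≤ D → (c : Circuit n k) → depth c ≤ D → Compiled c φ
    compile {k} {zero} (var i) h c hc = record
      { extended = record { circuit = c ; embeds = embeds-refl ; depth≤ = hc ; size≤ = m≤m+n k 0 }
      ; src = inj₁ i ; src✓ = λ _ → refl ; height≤ = z≤n }
    compile {k} {suc d} (lift φ) h c hc = record
      { extended = record { circuit = R.circuit ; embeds = R.embeds ; depth≤ = R.depth≤
                          ; size≤ = ≤-trans R.size≤ (+-monoʳ-≤ k (m≤n⇒m≤1+n (m≤m+n (gates d) _))) }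
      ; src = R.src ; src✓ = R.src✓ ; height≤ = m≤n⇒m≤1+n R.height≤ }
      where module R = Compiled (compile {d = d} φ (<⇒≤ h) c hc)
    compile {k} {suc d} (negate φ) h c hc =
      add-gate R.extended (s≤s (m≤m+n (gates d) _)) (NOT R.src) (λ x → cong not (R.src✓ x)) (s≤s R.height≤) h
      where module R = Compiled (compile {d = d} φ (<⇒≤ h) c hc)
    compile {k} {suc d} (and φs len) h c hc =
      add-gate R.extended (list-fits φs d len) (AND R.srcs) (λ x → cong (foldr _∧_ true) (R.srcs✓ x)) (s≤s (maxL≤ (Allₚ.map⁺ R.heights≤))) h
      where module R = CompiledList (compileList {d = d} φs (<⇒≤ h) c hc)
    compile {k} {suc d} (or φs len) h c hc =
      add-gate R.extended (list-fits φs d len) (OR R.srcs) (λ x → cong (foldr _∨_ false) (R.srcs✓ x)) (s≤s (maxL≤ (Allₚ.map⁺ R.heights≤))) h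
      where module R = CompiledList (compileList {d = d} φs (<⇒≤ h) c hc)
    compile {k} {suc d} (mod φs len) h c hc =
      add-gate R.extended (list-fits φs d len) (MOD R.srcs) (λ x → cong (λ bs → does (m ∣? countTrue bs)) (R.srcs✓ x)) (s≤s (maxL≤ (Allₚ.map⁺ R.heights≤))) h
      where module R = CompiledList (compileList {d = d} φs (<⇒≤ h) c hc)

    compileList : ∀ {d} (φs : List (Formula d)) → d ≤ D → (c : Circuit n k) → depth c ≤ D → CompiledList c φs
    compileList {k} []       h c hc = record
      { extended = record { circuit = c ; embeds = embeds-refl ; depth≤ = hc ; size≤ = m≤m+n k 0 }
      ; srcs = [] ; srcs✓ = λ _ → refl ; heights≤ = [] }
    compileList {k} {d} (φ ∷ φs) h c hc = record
      { extended = record { circuit = S.circuit ; embeds = embeds-trans R.embeds S.embeds ; depth≤ = S.depth≤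
                          ; size≤ = ≤-trans S.size≤ (≤-trans (+-monoˡ-≤ (length φs * gates d) R.size≤) (≤-reflexive (+-assoc k (gates d) (length φs * gates d)))) }
      ; srcs = E.emb R.src ∷ S.srcs
      ; srcs✓ = λ x → cong₂ _∷_ (trans (E.value≡ x R.src) (R.src✓ x)) (S.srcs✓ x)
      ; heights≤ = ≤-trans (≤-reflexive (E.height≡ R.src)) R.height≤ ∷ S.heights≤ }
      where
      module R = Compiled (compile {d = d} φ h c hc)
      module S = CompiledList (compileList {d = d} φs h R.circuit R.depth≤)
      module E = Embeds S.embeds

  compile-disjunction : ∀ {d} (φs : List (Formula d)) → length φs ≤ L → suc d ≤ D →
    ∃ λ s → Σ (Circuit n (suc s)) λ c → (∀ x → output m c x ≡ foldr _∨_ false (map (eval x) φs)) × depth c ≤ D × suc s ≤ (2 + L) ^ suc d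
  compile-disjunction {d} φs len h = R.size , (R.circuit ▷ OR R.srcs) , (λ x → cong (foldr _∨_ false) (R.srcs✓ x))
    , ⊔-lub (≤-trans (s≤s (maxL≤ (Allₚ.map⁺ R.heights≤))) h) R.depth≤
    , ≤-trans (s≤s R.size≤) (≤-trans (list-fits φs d len) (≤-trans (n≤1+n _) (gates< (suc d))))
    where module R = CompiledList (compileList φs (<⇒≤ h) [] z≤n)

-- The choice of parameters

n<2^[1+⌊log₂n⌋] : ∀ n → n < 2 ^ suc ⌊log₂ n ⌋
n<2^[1+⌊log₂n⌋] n = ≰⇒> λ h → 1+n≰n (subst (_≤ ⌊log₂ n ⌋) (⌊log₂[2^n]⌋≡n (suc ⌊log₂ n ⌋)) (⌊log₂⌋-mono-≤ h))

-- As n grows by one, t grows only when t^D = n, and then (t + 1)^D ≤ (2t)^D = 2^D·n.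
root : ∀ D → 0 < D → ∀ n → 0 < n → ∃ λ t → 0 < t × t ≤ n × n ≤ t ^ D × t ^ D ≤ 2 ^ D * n
root D 0<D (suc zero) _ = 1 , ≤-refl , ≤-refl , ≤-reflexive (sym (^-zeroˡ D))
  , ≤-trans (≤-reflexive (^-zeroˡ D)) (≤-trans (m^n>0 2 D) (≤-reflexive (sym (*-identityʳ (2 ^ D)))))
root D 0<D (suc n@(suc _)) _ with root D 0<D n (s≤s z≤n)
... | t , 0<t , t≤n , lo , hi with m≤n⇒m<n∨m≡n lo
...   | inj₁ n<t^D = t , 0<t , m≤n⇒m≤1+n t≤n , n<t^D , ≤-trans hi (*-monoʳ-≤ (2 ^ D) (n≤1+n n))
...   | inj₂ n≡t^D = suc t , s≤s z≤n , s≤s t≤n , subst (λ z → suc z ≤ suc t ^ D) (sym n≡t^D) (^-monoˡ-< D {{>-nonZero 0<D}} (n<1+n t))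
  , (begin
      suc t ^ D         ≤⟨ ^-monoˡ-≤ D (≤-trans (+-monoˡ-≤ t 0<t) (≤-reflexive (sym (2*n≡n+n t)))) ⟩
      (2 * t) ^ D       ≡⟨ ^-distribʳ-* 2 t D ⟩
      2 ^ D * t ^ D     ≡⟨ cong (2 ^ D *_) n≡t^D ⟨
      2 ^ D * n         ≤⟨ *-monoʳ-≤ (2 ^ D) (n≤1+n n) ⟩
      2 ^ D * suc n     ∎)
  where open ≤-Reasoning

n≤2^n : ∀ n → n ≤ 2 ^ n
n≤2^n n = ≤-trans (n≤1+n n) (suc≤2^ n)

2^-* : ∀ {a b} x y → a ≤ 2 ^ x → b ≤ 2 ^ y → a * b ≤ 2 ^ (x + y)
2^-* x y ha hb = ≤-trans (*-mono-≤ ha hb) (≤-reflexive (sym (^-distribˡ-+-* 2 x y)))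

2^-+ : ∀ {a b} x y → a ≤ 2 ^ x → b ≤ 2 ^ y → a + b ≤ 2 ^ suc (x + y)
2^-+ {a} {b} x y ha hb = begin
  a + b                            ≤⟨ +-mono-≤ (≤-trans ha (^-monoʳ-≤ 2 (m≤m+n x y))) (≤-trans hb (^-monoʳ-≤ 2 (m≤n+m y x))) ⟩
  2 ^ (x + y) + 2 ^ (x + y)        ≡⟨ 2*n≡n+n (2 ^ (x + y)) ⟨
  2 ^ suc (x + y)                  ∎
  where open ≤-Reasoning

2^-^ : ∀ {a} x k → a ≤ 2 ^ x → a ^ k ≤ 2 ^ (x * k)
2^-^ x k h = ≤-trans (^-monoˡ-≤ k h) (≤-reflexive (^-*-assoc 2 x k))

ones-cnt : ∀ {n} (x : Fin n → Bool) → ones x ≡ cnt x (allFin n)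
ones-cnt x = cong countTrue (sym (map-tabulate id x))

-- A canonical input with a given number of ones, through which a symmetric function becomes a
-- predicate of the count.
prefix : ∀ {n} → ℕ → Fin n → Bool
prefix zero    i       = false
prefix (suc c) zero    = true
prefix (suc c) (suc i) = prefix c i

ones-prefix : ∀ n c → c ≤ n → ones {n} (prefix c) ≡ c
ones-prefix zero    zero    h       = refl
ones-prefix (suc n) zero    h       = ones-prefix n zero z≤n
ones-prefix (suc n) (suc c) (s≤s h) = cong suc (ones-prefix n c h)

-- All counts of the construction are below 2 ^ K and all fan-ins are at most 2 ^ T.
module Exponents (m r K t : ℕ) where
  ζ e b̄ W X₁ X₂ X₃ X₄ T : ℕ
  ζ  = K + 3
  e  = t * suc (2 * K)
  b̄  = suc (8 * ζ * t) + suc K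
  W  = suc (suc b̄ + (r + (m + t) + m))
  X₁ = m + suc (K * (m * t) + suc m)
  X₂ = 2 + K * t + ζ
  X₃ = e + W
  X₄ = m + t + (K + (K + K) * e)
  T  = X₁ + X₂ + X₃ + X₄

-- Writing K and t as successors turns the difference of the two sides into a polynomial with
-- natural coefficients, displayed in `expand`. The dominant terms are of order t·K², from the
-- guesses.
T-bound : ∀ m r K t → 0 < K → 0 < t → 2 + Exponents.T m r K t ≤ (60 + 6 * m + r) * (t * (K * K))
T-bound m r (suc a) (suc t) _ _ = ≤-trans (m≤m+n (2 + Exponents.T m r (suc a) (suc t)) _) (≤-reflexive (sym (expand t a m r)))
  where
  expand : ∀ t a m r → (60 + 6 * m + r) * (suc t * (suc a * suc a)) ≡
    (2 + ((m + suc (suc a * (m * suc t) + suc m)) + (2 + suc a * suc t + (suc a + 3))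
      + (suc t * suc (2 * suc a) + suc (suc (suc (8 * (suc a + 3) * suc t) + suc (suc a)) + (r + (m + suc t) + m)))
      + (m + suc t + (suc a + (suc a + suc a) * (suc t * suc (2 * suc a))))))
    + ((13 + m) * (suc t * suc a * a) + 27 * (suc t * (a * (2 + a))) + 3 * (suc a * (t * suc a + a)) + (13 + 5 * m + r) * (t * (suc a * suc a) + a * (2 + a)))
  expand = solve-∀

module Construction (n m : ℕ) (qs : List ℕ) (uniq : Unique qs) (primes : All Prime qs) (m≡ : m ≡ product qs)
  (k P t lg : ℕ) (0<t : 0 < t) (t≤2^lg : t ≤ 2 ^ lg)
  (D≤P : (length qs + 3) * k + (length qs + 2) ≤ P) (n≤t^D : n ≤ t ^ ((length qs + 3) * k + (length qs + 2)))
  where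

  r K : ℕ
  r = length qs
  K = suc (lg * P)

  open Exponents m r K t

  J L w₀ : ℕ
  J  = t * t ^ r * t
  L  = 2 ^ T
  w₀ = 2 ^ b̄ + 2 ^ b̄ + r * (m * t) * m

  open ≤-Reasoning

  t^<2^K : ∀ i → i ≤ P → t ^ i < 2 ^ K
  t^<2^K i i≤P = ≤-<-trans (≤-trans (2^-^ lg i t≤2^lg) (^-monoʳ-≤ 2 (*-monoʳ-≤ lg i≤P))) (^-monoʳ-< 2 (s≤s (s≤s z≤n)) (n<1+n (lg * P)))

  J≡ : J ≡ t ^ (r + 2)
  J≡ = trans (*-assoc t (t ^ r) t) (trans (l t (t ^ r)) (sym (^-distribˡ-+-* t r 2)))
    where
    l : ∀ t p → t * (p * t) ≡ p * (t * (t * 1))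
    l = solve-∀

  J<2^K : J < 2 ^ K
  J<2^K = subst (_< 2 ^ K) (sym J≡) (t^<2^K (r + 2) (≤-trans (m≤n+m (r + 2) ((r + 3) * k)) D≤P))

  2J+1≤ : 2 * J + 1 ≤ 2 ^ suc K
  2J+1≤ = ≤-trans (≤-trans (m≤n+m (2 * J + 1) 1) (≤-reflexive (l J))) (*-monoʳ-≤ 2 J<2^K)
    where
    l : ∀ j → 1 + (2 * j + 1) ≡ 2 * suc j
    l = solve-∀

  X₁≤T : X₁ ≤ T
  X₁≤T = ≤-trans (m≤m+n X₁ X₂) (≤-trans (m≤m+n _ X₃) (m≤m+n _ X₄))

  X₂≤T : X₂ ≤ T
  X₂≤T = ≤-trans (m≤n+m X₂ X₁) (≤-trans (m≤m+n _ X₃) (m≤m+n _ X₄))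

  X₃≤T : X₃ ≤ T
  X₃≤T = ≤-trans (m≤n+m X₃ (X₁ + X₂)) (m≤m+n _ X₄)

  X₄≤T : X₄ ≤ T
  X₄≤T = m≤n+m X₄ (X₁ + X₂ + X₃)

  fits : m * (suc J ^ (m * t) + 2 * m) ≤ L
  fits = ≤-trans (2^-* m _ (n≤2^n m) (2^-+ (K * (m * t)) (suc m) (2^-^ K (m * t) J<2^K) (*-monoʳ-≤ 2 (n≤2^n m)))) (^-monoʳ-≤ 2 X₁≤T)

  Z≤ : 4 * (2 * J + 1) ≤ 2 ^ ζ
  Z≤ = ≤-trans (2^-* 2 (suc K) ≤-refl 2J+1≤) (≤-reflexive (cong (2 ^_) (+-comm 3 K)))

  K≤ : suc (2 * J ^ t) * ζ ≤ 2 ^ X₂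
  K≤ = 2^-* (2 + K * t) ζ (begin
      suc (2 * J ^ t)                ≤⟨ s≤s (*-monoʳ-≤ 2 (2^-^ K t (<⇒≤ J<2^K))) ⟩
      suc (2 * 2 ^ (K * t))          ≤⟨ +-monoˡ-≤ (2 * 2 ^ (K * t)) (≤-trans (m^n>0 2 (K * t)) (m≤m+n _ _)) ⟩
      2 * 2 ^ (K * t) + 2 * 2 ^ (K * t) ≡⟨ 2*n≡n+n (2 * 2 ^ (K * t)) ⟨
      2 ^ (2 + K * t)                ∎) (n≤2^n ζ)

  B≤ : 2 ^ suc (8 * ζ * t) * (2 * J + 1) ≤ 2 ^ b̄
  B≤ = 2^-* (suc (8 * ζ * t)) (suc K) ≤-refl 2J+1≤

  ℓ₀≥ : suc J * suc J ≤ 2 ^ (K + K)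
  ℓ₀≥ = 2^-* K K J<2^K J<2^K

  w₀≤ : w₀ ≤ 2 ^ W
  w₀≤ = 2^-+ (suc b̄) (r + (m + t) + m) (≤-reflexive (sym (2*n≡n+n (2 ^ b̄))))
    (2^-* (r + (m + t)) m (2^-* r (m + t) (n≤2^n r) (2^-* m t (n≤2^n m) (n≤2^n t))) (n≤2^n m))

  guesses≤L : t * suc (2 * K) * w₀ ≤ L
  guesses≤L = ≤-trans (2^-* e W (n≤2^n e) w₀≤) (^-monoʳ-≤ 2 X₃≤T)

  ℓ : ℕ
  ℓ = 2 ^ (K + (K + K) * e)

  ℓ≥ : 2 ^ K * (2 ^ (K + K)) ^ e ≤ ℓ
  ℓ≥ = 2^-* K ((K + K) * e) ≤-refl (2^-^ (K + K) e ≤-refl)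

  mtℓ≤L : m * t * ℓ ≤ L
  mtℓ≤L = ≤-trans (2^-* (m + t) (K + (K + K) * e) (2^-* m t (n≤2^n m) (n≤2^n t)) ≤-refl) (^-monoʳ-≤ 2 X₄≤T)

  mt≤L : m * t ≤ L
  mt≤L = ≤-trans (2^-* m t (n≤2^n m) (n≤2^n t)) (^-monoʳ-≤ 2 (≤-trans (m≤m+n (m + t) _) X₄≤T))

  ℓ≤L : ℓ ≤ L
  ℓ≤L = ^-monoʳ-≤ 2 (≤-trans (m≤n+m (K + (K + K) * e) (m + t)) X₄≤T)

  module S = Stages n m L qs uniq primes m≡ t ζ (2 ^ X₂) (2 ^ b̄) (2 ^ K) (2 ^ (K + K)) w₀ K ℓ
    0<t fits Z≤ K≤ (^-monoʳ-≤ 2 X₂≤T) B≤ ≤-refl ℓ₀≥ (^-monoʳ-≤ 2 (m≤m+n K K)) J<2^K ≤-refl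
    guesses≤L ℓ≥ (s≤s z≤n) mtℓ≤L mt≤L

  extent≡ : ∀ j → S.extent j ≡ t ^ ((r + 3) * j + (r + 2))
  extent≡ zero    = trans (l t (t ^ r)) (trans (sym (^-distribˡ-+-* t r 2)) (cong (λ z → t ^ (z + (r + 2))) (sym (*-zeroʳ (r + 3)))))
    where
    l : ∀ t p → t * (1 * p * t) ≡ p * (t * (t * 1))
    l = solve-∀
  extent≡ (suc j) = trans (cong₂ (λ u v → t * (u * v)) J≡ (extent≡ j))
    (trans (cong (t *_) (sym (^-distribˡ-+-* t (r + 2) _))) (cong (t ^_) (l r j)))
    where
    l : ∀ r j → suc (r + 2 + ((r + 3) * j + (r + 2))) ≡ (r + 3) * suc j + (r + 2)
    l = solve-∀

  small : ∀ j → j ≤ k → S.extent j < 2 ^ K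
  small j j≤k = subst (_< 2 ^ K) (sym (extent≡ j)) (t^<2^K _ (≤-trans (+-monoˡ-≤ (r + 2) (*-monoʳ-≤ (r + 3) j≤k)) D≤P))

  module _ (f : (Fin n → Bool) → Bool) where
    open Formulas n m L

    -- Its disjunction `ds` computes the negation of `not f`, that is f; closing it with one OR gate
    -- is the last level, 3(k + 1) + 1.
    conj : Conj (3 * suc k) ℓ (λ x → not (f (prefix (cnt x (allFin n)))))
    conj = S.counts k small (allFin n)
      (≤-trans (≤-reflexive (length-tabulate {n = n} id)) (subst (n ≤_) (sym (extent≡ k)) n≤t^D)) (f ∘ prefix)

    ones≡ : ∀ x → ones (prefix {n} (cnt x (allFin n))) ≡ ones x
    ones≡ x = trans (ones-prefix n _ (≤-trans (cnt≤length x (allFin n)) (≤-reflexive (length-tabulate {n = n} id)))) (sym (ones-cnt x))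

    2+L≤ : 2 + L ≤ 2 ^ (2 + T)
    2+L≤ = begin
      2 + L             ≤⟨ +-monoˡ-≤ L (*-monoʳ-≤ 2 (m^n>0 2 T)) ⟩
      2 * L + L         ≤⟨ +-monoʳ-≤ (2 * L) (m≤m+n L _) ⟩
      2 * L + 2 * L     ≡⟨ 2*n≡n+n (2 * L) ⟨
      2 ^ (2 + T)       ∎

    symmetric-circuit : Symmetric f → Σ ℕ λ s → Σ (Circuit n (suc s)) λ c →
      Computes m c f × depth c ≤ suc (3 * suc k) × suc s ≤ 2 ^ ((2 + T) * suc (3 * suc k))
    symmetric-circuit sym-f =
      let s , c , computes , d≤ , s≤ = Compile.compile-disjunction n m L (suc (3 * suc k)) (Conj.ds conj) (≤-trans (Conj.ds≤ conj) ℓ≤L) ≤-refl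
      in s , c
        , (λ x → trans (computes x) (trans (Conj.ds✓ conj x) (trans (not-involutive _) (sym-f _ x (ones≡ x)))))
        , d≤ , ≤-trans s≤ (2^-^ (2 + T) (suc (3 * suc k)) 2+L≤)

-- With D = (r + 3)k + r + 2, τ is at most c₁·t·log² n and t^D ≤ 2^D·n. Raising τ to the power 3D
-- clears the fractional exponent of n; the constants become c₁^(3D)·(2^D)^3 and the logarithm gets
-- exponent 2·3D.
symmetric-circuits : ∀ m r → Good m r → ∀ k →
    Σ ℕ λ C → Σ ℕ λ κ → Σ ℕ λ N →
    (n : ℕ) → N ≤ n →
    (f : (Fin n → Bool) → Bool) → Symmetric f →
    Σ ℕ λ s → Σ (Circuit n (suc s)) λ c →
    Computes m c f × depth c ≤ suc (3 * suc k) ×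
    (Σ ℕ λ τ → suc s ≤ 2 ^ τ ×
    τ ^ (3 * ((r + 3) * k + (r + 2))) ≤ C * n ^ 3 * (suc ⌊log₂ n ⌋) ^ κ)
symmetric-circuits m _ (_ , (qs , refl , uniq , primes , m≡) , _) k = C , 2 * (3 * D) , 1 , build
  where
  r D P c₁ C : ℕ
  r = length qs
  D = (r + 3) * k + (r + 2)
  P = D
  c₁ = (60 + 6 * m + r) * (suc P * suc P) * suc (3 * suc k)
  C = c₁ ^ (3 * D) * (2 ^ D) ^ 3
  0<D : 0 < D
  0<D = ≤-trans (≤-trans (s≤s z≤n) (m≤n+m 2 r)) (m≤n+m (r + 2) ((r + 3) * k))
  build : (n : ℕ) → 1 ≤ n → (f : (Fin n → Bool) → Bool) → Symmetric f →
    Σ ℕ λ s → Σ (Circuit n (suc s)) λ c → Computes m c f × depth c ≤ suc (3 * suc k) ×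
    (Σ ℕ λ τ → suc s ≤ 2 ^ τ × τ ^ (3 * D) ≤ C * n ^ 3 * (suc ⌊log₂ n ⌋) ^ (2 * (3 * D)))
  build n 0<n f sym-f with root D 0<D n 0<n
  ... | t , 0<t , t≤n , n≤t^D , t^D≤ =
    let s , c , computes , d≤ , s≤ = Construction.symmetric-circuit n m qs uniq primes m≡ k P t lg 0<t
          (≤-trans t≤n (<⇒≤ (n<2^[1+⌊log₂n⌋] n))) ≤-refl n≤t^D f sym-f
    in s , c , computes , d≤ , (2 + T) * suc (3 * suc k) , s≤ , bound
    where
    lg : ℕ
    lg = suc ⌊log₂ n ⌋
    open Exponents m r (suc (lg * P)) t using (T)
    open ≤-Reasoning
    τ≤ : (2 + T) * suc (3 * suc k) ≤ c₁ * (t * (lg * lg))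
    τ≤ = begin
      (2 + T) * suc (3 * suc k)                            ≤⟨ *-monoˡ-≤ (suc (3 * suc k)) (T-bound m r (suc (lg * P)) t (s≤s z≤n) 0<t) ⟩
      c₀ * (t * (suc (lg * P) * suc (lg * P))) * suc (3 * suc k) ≤⟨ *-monoˡ-≤ (suc (3 * suc k)) (*-monoʳ-≤ c₀ (*-monoʳ-≤ t (*-mono-≤ K≤ K≤))) ⟩
      c₀ * (t * (suc P * lg * (suc P * lg))) * suc (3 * suc k) ≡⟨ l c₀ t (suc P) lg (suc (3 * suc k)) ⟩
      c₁ * (t * (lg * lg))                                  ∎
      where
      c₀ : ℕ
      c₀ = 60 + 6 * m + r
      K≤ : suc (lg * P) ≤ suc P * lg
      K≤ = +-mono-≤ (s≤s (z≤n {⌊log₂ n ⌋})) (≤-reflexive (*-comm lg P))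
      l : ∀ c t p g d → c * (t * (p * g * (p * g))) * d ≡ c * (p * p) * d * (t * (g * g))
      l = solve-∀
    bound : ((2 + T) * suc (3 * suc k)) ^ (3 * D) ≤ C * n ^ 3 * lg ^ (2 * (3 * D))
    bound = begin
      ((2 + T) * suc (3 * suc k)) ^ (3 * D)                ≤⟨ ^-monoˡ-≤ (3 * D) τ≤ ⟩
      (c₁ * (t * (lg * lg))) ^ (3 * D)                      ≡⟨ trans (^-distribʳ-* c₁ (t * (lg * lg)) (3 * D)) (cong (c₁ ^ (3 * D) *_) (^-distribʳ-* t (lg * lg) (3 * D))) ⟩
      c₁ ^ (3 * D) * (t ^ (3 * D) * (lg * lg) ^ (3 * D))    ≡⟨ cong₂ (λ u v → c₁ ^ (3 * D) * (u * v)) t-power lg-power ⟩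
      c₁ ^ (3 * D) * ((t ^ D) ^ 3 * lg ^ (2 * (3 * D)))     ≤⟨ *-monoʳ-≤ (c₁ ^ (3 * D)) (*-monoˡ-≤ (lg ^ (2 * (3 * D))) (≤-trans (^-monoˡ-≤ 3 t^D≤) (≤-reflexive (^-distribʳ-* (2 ^ D) n 3)))) ⟩
      c₁ ^ (3 * D) * ((2 ^ D) ^ 3 * n ^ 3 * lg ^ (2 * (3 * D))) ≡⟨ l (c₁ ^ (3 * D)) ((2 ^ D) ^ 3) (n ^ 3) (lg ^ (2 * (3 * D))) ⟩
      C * n ^ 3 * lg ^ (2 * (3 * D))                       ∎
      where
      t-power : t ^ (3 * D) ≡ (t ^ D) ^ 3
      t-power = trans (cong (t ^_) (*-comm 3 D)) (sym (^-*-assoc t D 3))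
      lg-power : (lg * lg) ^ (3 * D) ≡ lg ^ (2 * (3 * D))
      lg-power = trans (cong (λ z → (lg * z) ^ (3 * D)) (sym (*-identityʳ lg))) (^-*-assoc lg 2 (3 * D))
      l : ∀ a b c d → a * (b * c * d) ≡ a * b * c * d
      l = solve-∀

theorem1p4 : (m r : ℕ) → Good m r →
    (d : ℕ) → 4 ≤ d → d % 3 ≡ 1 →
    Σ ℕ λ C → Σ ℕ λ k → Σ ℕ λ N →
    (n : ℕ) → N ≤ n →
    (f : (Fin n → Bool) → Bool) → Symmetric f →
    Σ ℕ λ s → Σ (Circuit n (suc s)) λ c →
    Computes m c f × depth c ≤ d ×
    (Σ ℕ λ t → suc s ≤ 2 ^ t ×
    t ^ ((r + 3) * (d ∸ 1) ∸ 3) ≤ C * n ^ 3 * (suc ⌊log₂ n ⌋) ^ k)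
theorem1p4 m r good d 4≤d d%3≡1 = go (d / 3) (trans (m≡m%n+[m/n]*n d 3) (cong (_+ d / 3 * 3) d%3≡1))
  where
  Claim : ℕ → ℕ → Set
  Claim d e = Σ ℕ λ C → Σ ℕ λ k → Σ ℕ λ N →
    (n : ℕ) → N ≤ n →
    (f : (Fin n → Bool) → Bool) → Symmetric f →
    Σ ℕ λ s → Σ (Circuit n (suc s)) λ c →
    Computes m c f × depth c ≤ d ×
    (Σ ℕ λ t → suc s ≤ 2 ^ t × t ^ e ≤ C * n ^ 3 * (suc ⌊log₂ n ⌋) ^ k)
  -- Here 3/((r + 3)(d - 1) - 3) is recognised as 1/D; the subtracted 3 is the factor t that the
  -- first stage loses.
  exponent≡ : ∀ k → (r + 3) * (3 * suc k) ∸ 3 ≡ 3 * ((r + 3) * k + (r + 2))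
  exponent≡ k = trans (cong (_∸ 3) (l r k)) (m+n∸n≡m _ 3)
    where
    l : ∀ r k → (r + 3) * (3 * suc k) ≡ 3 * ((r + 3) * k + (r + 2)) + 3
    l = solve-∀
  go : ∀ j → d ≡ 1 + j * 3 → Claim d ((r + 3) * (d ∸ 1) ∸ 3)
  go zero    refl = ⊥-elim (<⇒≱ (s≤s (s≤s z≤n)) 4≤d)
  go (suc k) d≡ = subst (λ d → Claim d ((r + 3) * (d ∸ 1) ∸ 3)) (sym (trans d≡ (cong suc (*-comm (suc k) 3))))
    (subst (Claim (suc (3 * suc k))) (sym (exponent≡ k)) (symmetric-circuits m r good k))
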